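{- Let $\beta>0$ be real. The asymptotic competitive search ratio $\hat S$ satisfies: (1) $\hat S(\beta)\le 4$ if $\beta\le 13/34$; (2) $\hat S(\beta)\le 6$ if $\beta\le 47/110$; (3) $\hat S(\beta)\le 8$ if $\beta\le 157/346$.
   Context: Model. $n$ robots with distinct identities start at time $0$ at the origin of the real line and move along the line with speed at most $1$, changing direction or speed at no cost. A target lies at an unknown point at distance $d>0$ from the origin, i.e. at $d$ or $-d$, with $d$ unknown to the robots. At most $f$ robots are faulty; the bound $f$ is known, but not which robots are faulty. A search algorithm assigns each robot a trajectory, known to all robots; a robot's further motion may depend on the messages broadcast so far (computation and communication take no time). A robot detects whether the target is at a point only by being there. The only messages are announcements "the target is here", heard instantly by all robots at any distance; each message automatically carries the true identity and true current location of its sender. A robot visiting a point silently is taken to claim that the target is not there. Reliable (non-faulty) robots follow the algorithm and report truthfully. Faulty robots are controlled by an adversary: they may stay silent at the target or announce the target where it is not; a faulty robot that broadcasts while off its assigned trajectory is thereby detected as faulty. The search is completed at the first time when some reliable robot has visited the target and announced it and all reliable robots can be certain of its location (every scenario with at most $f$ faulty robots consistent with the messages so far has the target at that location). For an algorithm, the search time $S_d(n,f)$ is the worst-case completion time over both positions $\pm d$ of the target, all choices of at most $f$ faulty robots, and all behaviours of the faulty robots. The inequality $S_d(n,f)\le cd$ means that there is an algorithm, not depending on $d$, with search time at most $cd$ for every $d>0$. Asymptotic ratio. For non-integer $n$, $S_d(n,f)$ means $S_d(\lceil n\rceil,f)$ ($f$ is always an integer). For a density $\beta=f/n>0$ of faulty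 robots, $$\hat S(\beta)=\min\{\alpha \mid \exists \text{ a constant } c_\beta \text{ such that for all integers } f>0,\ S_d(f/\beta+c_\beta,f)\le \alpha d\}.$$ -}

module Defs where

open import Level using (0ℓ)
open import Algebra.Structures using (IsCommutativeRing)
open import Data.Fin using (Fin)
open import Data.Fin.Subset using (Subset; ∣_∣; _∉_)
open import Data.Maybe using (Maybe; just)
open import Data.Nat as ℕ using (ℕ)
open import Data.Product using (Σ-syntax; ∃-syntax; _×_)
open import Data.Sum using (_⊎_)
open import Relation.Binary.Core using (Rel)
open import Relation.Binary.Structures using (IsTotalOrder)
open import Relation.Binary.PropositionalEquality using (_≡_; _≢_)

-- Classically these axioms determine the real numbers up to isomorphism;
-- results about ℝ are stated for an arbitrary model.
record CompleteOrderedField : Set₁ where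
  infix  9 _⁻¹
  infix  8 -_
  infixl 7 _*_ _/_
  infixl 6 _+_ _-_
  infix  4 _≤_ _<_

  field
    ℝ    : Set
    _+_  : ℝ → ℝ → ℝ
    _*_  : ℝ → ℝ → ℝ
    -_   : ℝ → ℝ
    _⁻¹  : ℝ → ℝ
    0#   : ℝ
    1#   : ℝ
    _≤_  : Rel ℝ 0ℓ

    isCommutativeRing : IsCommutativeRing _≡_ _+_ _*_ -_ 0# 1#
    0≢1               : 0# ≢ 1#
    -- The value of 0# ⁻¹ is left unspecified.
    *-inverseʳ        : ∀ x → x ≢ 0# → x * x ⁻¹ ≡ 1#

    isTotalOrder      : IsTotalOrder _≡_ _≤_
    +-monoˡ-≤         : ∀ z {x y} → x ≤ y → x + z ≤ y + z
    *-nonNeg          : ∀ {x y} → 0# ≤ x → 0# ≤ y → 0# ≤ x * y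

  UpperBound : (ℝ → Set) → ℝ → Set
  UpperBound P u = ∀ x → P x → x ≤ u

  field
    supremum : ∀ (P : ℝ → Set) → (∃[ x ] P x) → (∃[ u ] UpperBound P u) →
               ∃[ s ] (UpperBound P s × (∀ u → UpperBound P u → s ≤ u))

  _<_ : Rel ℝ 0ℓ
  x < y = x ≤ y × x ≢ y

  _-_ : ℝ → ℝ → ℝ
  x - y = x + (- y)

  _/_ : ℝ → ℝ → ℝ
  x / y = x * y ⁻¹

  fromℕ : ℕ → ℝ
  fromℕ ℕ.zero    = 0#
  fromℕ (ℕ.suc n) = 1# + fromℕ n

  IsCeiling : ℝ → ℕ → Set
  IsCeiling x n = fromℕ n - 1# < x × x ≤ fromℕ n

module Search (R : CompleteOrderedField) where
  open CompleteOrderedField R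

  -- A motion from the origin with speed at most 1.  Functions of time are
  -- total on ℝ, but only their values at times t ≥ 0 are ever constrained
  -- or used.
  record IsTrajectory (p : ℝ → ℝ) : Set where
    field
      start : p 0# ≡ 0#
      speed : ∀ s t → 0# ≤ s → s ≤ t →
              p t - p s ≤ t - s × p s - p t ≤ t - s

  -- H i t ≡ just y : at time t robot i announces "the target is here", the
  -- automatically attached location being y.  H i t ≡ nothing : i is silent.
  Transcript : ℕ → Set
  Transcript n = Fin n → ℝ → Maybe ℝ

  AgreeBefore : ∀ {n} → ℝ → Transcript n → Transcript n → Set
  AgreeBefore t H H′ = ∀ i s → 0# ≤ s → s < t → H i s ≡ H′ i s

  AgreeUpTo : ∀ {n} → ℝ → Transcript n → Transcript n → Set
  AgreeUpTo t H H′ = ∀ i s → 0# ≤ s → s ≤ t → H i s ≡ H′ i s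

  -- The messages sent at time t itself cannot influence the positions at
  -- time t, because trajectories are continuous; hence AgreeBefore.
  record Algorithm (n : ℕ) : Set where
    field
      position     : Transcript n → Fin n → ℝ → ℝ
      isTrajectory : ∀ H i → IsTrajectory (position H i)
      causal       : ∀ H H′ t → 0# ≤ t → AgreeBefore t H H′ →
                     ∀ i → position H i t ≡ position H′ i t

  -- A complete run of the algorithm against the adversary.  Faulty robots
  -- move (at speed at most 1) and announce as they please, except that they
  -- cannot forge their identity or location.
  record Scenario {n : ℕ} (A : Algorithm n) (f : ℕ) : Set where
    open Algorithm A
    field
      target       : ℝ
      target≢0     : target ≢ 0#
      faulty       : Subset n
      faulty≤f     : ∣ faulty ∣ ℕ.≤ f
      transcript   : Transcript n
      path         : Fin n → ℝ → ℝ
      isTrajectory : ∀ i → IsTrajectory (path i)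
      trueLocation : ∀ i t y → 0# ≤ t → transcript i t ≡ just y → path i t ≡ y
      follows      : ∀ i → i ∉ faulty → ∀ t → 0# ≤ t →
                     path i t ≡ position transcript i t
      truthful     : ∀ i → i ∉ faulty → ∀ t y → 0# ≤ t →
                     transcript i t ≡ just y → y ≡ target
      -- A reliable robot announces the target at its first visit; it may,
      -- but need not, repeat the announcement at later visits.  Demanding
      -- an announcement at every visit would let an algorithm whose motion
      -- depends on infinitely many visits in bounded time have no run at
      -- all, and so succeed vacuously.
      reports      : ∀ i → i ∉ faulty → ∀ t → 0# ≤ t → path i t ≡ target →
                     ∃[ s ] (0# ≤ s × s ≤ t × transcript i s ≡ just target)

  module _ {n : ℕ} {A : Algorithm n} {f : ℕ} where
    open Scenario

    Announced : Scenario A f → ℝ → Set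
    Announced σ T = ∃[ i ] ∃[ s ]
      (i ∉ faulty σ × 0# ≤ s × s ≤ T × transcript σ i s ≡ just (target σ))

    Certain : Scenario A f → ℝ → Set
    Certain σ T = ∀ (τ : Scenario A f) →
      AgreeUpTo T (transcript σ) (transcript τ) → target τ ≡ target σ

    -- Both conditions persist as T grows.
    CompletedBy : Scenario A f → ℝ → Set
    CompletedBy σ T = Announced σ T × Certain σ T

  -- S_d(n,f) ≤ c d, i.e. one algorithm achieves it for all d > 0.
  SearchTime≤ : ℕ → ℕ → ℝ → Set
  SearchTime≤ n f c = Σ[ A ∈ Algorithm n ]
    (∀ d → 0# < d → (σ : Scenario A f) →
     (Scenario.target σ ≡ d ⊎ Scenario.target σ ≡ - d) →
     ∃[ T ] (T ≤ c * d × CompletedBy σ T))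

  -- The set of α whose minimum is Ŝ(β).
  Achievable : ℝ → ℝ → Set
  Achievable β α = ∃[ c ] (∀ f → 0 ℕ.< f →
    ∃[ n ] (IsCeiling (fromℕ f / β + c) n × SearchTime≤ n f α))

  Ŝ[_]≤_ : ℝ → ℝ → Set
  Ŝ[ β ]≤ a = ∃[ α ] (α ≤ a × Achievable β α)

{-# OPTIONS --safe #-}

-- Two equal groups of robots sweep the line to the left and to the right at unit
-- speed.  A claim supported by too few robots of the sweeping group is refuted by
-- the silent rest of that group.  When a serious claim is made at distance x, all
-- robots return to the origin and both sweeps start afresh, robots of the other
-- group being sent towards the claim; once they have passed it, the claim is
-- settled, and if it was false then its supporters are exposed, so that the
-- remaining robots contain a smaller proportion of faulty ones.  A target that is
-- still to be found has distance at least x, so a restart costs at most twice that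
-- distance.  After the last restart, some robots wait at the origin and at the next
-- serious claim they follow the sweep on its side, while the other group has become
-- large enough to decide alone.  Hence r restarts give the ratio 2 r + 2.
--
-- Correctness is a comparison of two scenarios with the same messages and different
-- targets: a robot that has passed one of the targets is faulty in one of the two.
module Submission where

open import Defs
open import Level using (0ℓ)
open import Axiom.ExcludedMiddle using (ExcludedMiddle)
open import Algebra.Bundles using (CommutativeRing)
import Algebra.Properties.Ring as RingProperties
import Algebra.Solver.Ring as RingSolver
open import Algebra.Solver.Ring.AlmostCommutativeRing using (fromCommutativeRing; _-Raw-AlmostCommutative⟶_)
open import Data.Bool using (T)
open import Data.Fin using (Fin; zero; suc)
open import Data.Fin.Subset using (Subset; ∣_∣; _∈_; _∉_; _⊆_; _∪_; _∩_; ∁; ⊤; ⊥; inside; outside)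
open import Data.Fin.Subset.Properties
open import Data.Integer as ℤ using (ℤ; -[1+_]; _⊖_)
import Data.Integer.Properties as ℤₚ
open import Data.Maybe using (Maybe; just; nothing; map)
open import Data.Nat as ℕ using (ℕ; zero; suc; _≤ᵇ_; _<ᵇ_)
open import Data.Nat.DivMod using (m/n*n≤m; m≡m%n+[m/n]*n; m%n<n)
import Data.Nat.Properties as ℕₚ
open import Data.Nat.Tactic.RingSolver using () renaming (solve-∀ to ℕ-solve-∀)
open import Data.Product using (_×_; _,_; proj₁; proj₂; ∃; ∃-syntax; -,_)
open import Data.Sum using (_⊎_; inj₁; inj₂)
open import Data.Vec using ([]; _∷_; here; there; tabulate)
open import Data.Vec.Properties using (lookup∘tabulate; tabulate-cong; []=⇒lookup; lookup⇒[]=)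
open import Function using (_∘_)
open import Relation.Binary.Consequences using (dec⇒weaklyDec)
open import Relation.Binary.PropositionalEquality
open import Relation.Binary.Structures using (IsTotalOrder)
open import Relation.Nullary using (¬_; Dec; yes; no; does; contradiction)
open import Relation.Nullary.Decidable using (dec-true; dec-false)

-- Arithmetic and order of the reals.

module RealArithmetic (R : CompleteOrderedField) where
  open CompleteOrderedField R

  ℝ-commutativeRing : CommutativeRing 0ℓ 0ℓ
  ℝ-commutativeRing = record { isCommutativeRing = isCommutativeRing }

  open CommutativeRing ℝ-commutativeRing public
    using (+-assoc; +-comm; +-identityˡ; +-identityʳ; -‿inverseˡ; -‿inverseʳ;
           *-assoc; *-comm; *-identityˡ; *-identityʳ; zeroˡ; distribʳ)
  open RingProperties (CommutativeRing.ring ℝ-commutativeRing) public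
    using (-‿distribˡ-*; -‿distribʳ-*; -‿involutive; -0#≈0#; -‿+-comm)
  open ≡-Reasoning

  fromℕ-+ : ∀ m n → fromℕ (m ℕ.+ n) ≡ fromℕ m + fromℕ n
  fromℕ-+ zero    n = sym (+-identityˡ _)
  fromℕ-+ (suc m) n = trans (cong (1# +_) (fromℕ-+ m n)) (sym (+-assoc _ _ _))

  fromℕ-* : ∀ m n → fromℕ (m ℕ.* n) ≡ fromℕ m * fromℕ n
  fromℕ-* zero    n = sym (zeroˡ _)
  fromℕ-* (suc m) n = begin
    fromℕ (n ℕ.+ m ℕ.* n)             ≡⟨ fromℕ-+ n _ ⟩
    fromℕ n + fromℕ (m ℕ.* n)         ≡⟨ cong₂ _+_ (sym (*-identityˡ _)) (fromℕ-* m n) ⟩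
    1# * fromℕ n + fromℕ m * fromℕ n  ≡⟨ sym (distribʳ _ _ _) ⟩
    fromℕ (suc m) * fromℕ n           ∎

  fromℤ : ℤ → ℝ
  fromℤ (ℤ.+ n)    = fromℕ n
  fromℤ -[1+ n ]   = - fromℕ (suc n)

  fromℤ-⊖ : ∀ m n → fromℤ (m ⊖ n) ≡ fromℕ m - fromℕ n
  fromℤ-⊖ m       zero    = sym (trans (cong (fromℕ m +_) -0#≈0#) (+-identityʳ (fromℕ m)))
  fromℤ-⊖ zero    (suc n) = sym (+-identityˡ _)
  fromℤ-⊖ (suc m) (suc n) = begin
    fromℤ (suc m ⊖ suc n)                    ≡⟨ cong fromℤ (ℤₚ.[1+m]⊖[1+n]≡m⊖n m n) ⟩
    fromℤ (m ⊖ n)                            ≡⟨ fromℤ-⊖ m n ⟩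
    fromℕ m - fromℕ n                        ≡⟨ cong (_- fromℕ n) (sym (+-identityˡ _)) ⟩
    0# + fromℕ m - fromℕ n                   ≡⟨ cong (λ z → z + fromℕ m - fromℕ n) (sym (-‿inverseʳ 1#)) ⟩
    1# - 1# + fromℕ m - fromℕ n              ≡⟨ cong (_- fromℕ n) (trans (+-assoc _ _ _) (trans (cong (1# +_) (+-comm _ _)) (sym (+-assoc _ _ _)))) ⟩
    1# + fromℕ m + - 1# - fromℕ n            ≡⟨ +-assoc _ _ _ ⟩
    1# + fromℕ m + (- 1# - fromℕ n)          ≡⟨ cong (fromℕ (suc m) +_) (-‿+-comm _ _) ⟩
    fromℕ (suc m) - fromℕ (suc n)            ∎

  fromℤ-+ : ∀ i j → fromℤ (i ℤ.+ j) ≡ fromℤ i + fromℤ j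
  fromℤ-+ (ℤ.+ m)  (ℤ.+ n)  = fromℕ-+ m n
  fromℤ-+ (ℤ.+ m)  -[1+ n ] = fromℤ-⊖ m (suc n)
  fromℤ-+ -[1+ m ] (ℤ.+ n)  = trans (fromℤ-⊖ n (suc m)) (+-comm _ _)
  fromℤ-+ -[1+ m ] -[1+ n ] = begin
    - fromℕ (suc (suc (m ℕ.+ n)))     ≡⟨ cong (λ k → - fromℕ k) (sym (ℕₚ.+-suc (suc m) n)) ⟩
    - fromℕ (suc m ℕ.+ suc n)         ≡⟨ cong -_ (fromℕ-+ (suc m) (suc n)) ⟩
    - (fromℕ (suc m) + fromℕ (suc n)) ≡⟨ sym (-‿+-comm _ _) ⟩
    - fromℕ (suc m) - fromℕ (suc n)   ∎

  fromℤ-neg : ∀ i → fromℤ (ℤ.- i) ≡ - fromℤ i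
  fromℤ-neg (ℤ.+ zero)  = sym -0#≈0#
  fromℤ-neg (ℤ.+ suc n) = refl
  fromℤ-neg -[1+ n ]    = sym (-‿involutive _)

  fromℤ-*⁺ : ∀ m j → fromℤ (ℤ.+ m ℤ.* j) ≡ fromℕ m * fromℤ j
  fromℤ-*⁺ m (ℤ.+ n)  = trans (cong fromℤ (sym (ℤₚ.pos-* m n))) (fromℕ-* m n)
  fromℤ-*⁺ m -[1+ n ] = begin
    fromℤ (ℤ.+ m ℤ.* -[1+ n ])         ≡⟨ cong fromℤ (sym (ℤₚ.neg-distribʳ-* (ℤ.+ m) (ℤ.+ suc n))) ⟩
    fromℤ (ℤ.- (ℤ.+ m ℤ.* ℤ.+ suc n))  ≡⟨ fromℤ-neg (ℤ.+ m ℤ.* ℤ.+ suc n) ⟩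
    - fromℤ (ℤ.+ m ℤ.* ℤ.+ suc n)      ≡⟨ cong -_ (fromℤ-*⁺ m (ℤ.+ suc n)) ⟩
    - (fromℕ m * fromℕ (suc n))        ≡⟨ -‿distribʳ-* _ _ ⟩
    fromℕ m * - fromℕ (suc n)          ∎

  fromℤ-* : ∀ i j → fromℤ (i ℤ.* j) ≡ fromℤ i * fromℤ j
  fromℤ-* (ℤ.+ m)  j = fromℤ-*⁺ m j
  fromℤ-* -[1+ m ] j = begin
    fromℤ (-[1+ m ] ℤ.* j)         ≡⟨ cong fromℤ (sym (ℤₚ.neg-distribˡ-* (ℤ.+ suc m) j)) ⟩
    fromℤ (ℤ.- (ℤ.+ suc m ℤ.* j))  ≡⟨ fromℤ-neg (ℤ.+ suc m ℤ.* j) ⟩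
    - fromℤ (ℤ.+ suc m ℤ.* j)      ≡⟨ cong -_ (fromℤ-*⁺ (suc m) j) ⟩
    - (fromℕ (suc m) * fromℤ j)    ≡⟨ -‿distribˡ-* _ _ ⟩
    - fromℕ (suc m) * fromℤ j      ∎

  -- Integer coefficients have decidable equality, so through this map the ring solver can normalise
  -- identities over the abstract field.
  fromℤ-homomorphism : CommutativeRing.rawRing ℤₚ.+-*-commutativeRing
                         -Raw-AlmostCommutative⟶ fromCommutativeRing ℝ-commutativeRing
  fromℤ-homomorphism = record
    { ⟦_⟧    = fromℤ
    ; +-homo = fromℤ-+
    ; *-homo = fromℤ-*
    ; -‿homo = fromℤ-neg
    ; 0-homo = refl
    ; 1-homo = +-identityʳ 1#
    }

  open RingSolver (CommutativeRing.rawRing ℤₚ.+-*-commutativeRing)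
    (fromCommutativeRing ℝ-commutativeRing) fromℤ-homomorphism
    (λ i j → map (cong fromℤ) (dec⇒weaklyDec ℤ._≟_ i j)) public
    using (solve; _:=_; _:+_; _:*_; _:-_; :-_)

  open IsTotalOrder isTotalOrder public
    using () renaming (refl to ≤-refl; reflexive to ≤-reflexive; trans to ≤-trans;
                       antisym to ≤-antisym; total to ≤-total)

  +-monoʳ-≤ : ∀ z {x y} → x ≤ y → z + x ≤ z + y
  +-monoʳ-≤ z x≤y = subst₂ _≤_ (+-comm _ z) (+-comm _ z) (+-monoˡ-≤ z x≤y)

  +-mono-≤ : ∀ {w x y z} → w ≤ x → y ≤ z → w + y ≤ x + z
  +-mono-≤ w≤x y≤z = ≤-trans (+-monoˡ-≤ _ w≤x) (+-monoʳ-≤ _ y≤z)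

  +-cancelʳ-≤ : ∀ z {x y} → x + z ≤ y + z → x ≤ y
  +-cancelʳ-≤ z p = subst₂ _≤_ (cancel _ z) (cancel _ z) (+-monoˡ-≤ (- z) p)
    where cancel : ∀ x z → x + z - z ≡ x
          cancel = solve 2 (λ x z → x :+ z :- z := x) refl

  x≤y⇒0≤y-x : ∀ {x y} → x ≤ y → 0# ≤ y - x
  x≤y⇒0≤y-x {x} p = subst (_≤ _) (-‿inverseʳ x) (+-monoˡ-≤ (- x) p)

  0≤y-x⇒x≤y : ∀ {x y} → 0# ≤ y - x → x ≤ y
  0≤y-x⇒x≤y {x} {y} p = +-cancelʳ-≤ (- x) (subst (_≤ y - x) (sym (-‿inverseʳ x)) p)

  +-nonNeg : ∀ {x y} → 0# ≤ x → 0# ≤ y → 0# ≤ x + y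
  +-nonNeg {x} {y} 0≤x 0≤y = subst (_≤ x + y) (+-identityʳ 0#) (+-mono-≤ 0≤x 0≤y)

  x≤x+y : ∀ {x y} → 0# ≤ y → x ≤ x + y
  x≤x+y {x} {y} 0≤y = subst (_≤ x + y) (+-identityʳ x) (+-monoʳ-≤ x 0≤y)

  neg-antimono-≤ : ∀ {x y} → x ≤ y → - y ≤ - x
  neg-antimono-≤ {x} {y} p = 0≤y-x⇒x≤y (subst (0# ≤_) (flip-sign x y) (x≤y⇒0≤y-x p))
    where flip-sign : ∀ x y → y - x ≡ - x - - y
          flip-sign = solve 2 (λ x y → y :- x := :- x :- :- y) refl

  *-monoʳ-≤-nonNeg : ∀ z {x y} → 0# ≤ z → x ≤ y → x * z ≤ y * z
  *-monoʳ-≤-nonNeg z {x} {y} 0≤z x≤y =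
    0≤y-x⇒x≤y (subst (0# ≤_) (factor x y z) (*-nonNeg (x≤y⇒0≤y-x x≤y) 0≤z))
    where factor : ∀ x y z → (y - x) * z ≡ y * z - x * z
          factor = solve 3 (λ x y z → (y :- x) :* z := y :* z :- x :* z) refl

  0≤1 : 0# ≤ 1#
  0≤1 with ≤-total 0# 1#
  ... | inj₁ p = p
  ... | inj₂ p = ≤-trans (*-nonNeg 0≤-1 0≤-1) (≤-reflexive (square 1#))
    where
    0≤-1 : 0# ≤ - 1#
    0≤-1 = subst (_≤ - 1#) -0#≈0# (neg-antimono-≤ p)
    square : ∀ x → - 1# * - x ≡ x
    square x = trans (sym (-‿distribˡ-* _ _)) (trans (cong -_ (*-identityˡ _)) (-‿involutive x))

  0≤fromℕ : ∀ n → 0# ≤ fromℕ n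
  0≤fromℕ zero    = ≤-refl
  0≤fromℕ (suc n) = +-nonNeg 0≤1 (0≤fromℕ n)

  fromℕ-mono-≤ : ∀ {m n} → m ℕ.≤ n → fromℕ m ≤ fromℕ n
  fromℕ-mono-≤ {n = n} ℕ.z≤n = 0≤fromℕ n
  fromℕ-mono-≤ (ℕ.s≤s p) = +-monoʳ-≤ 1# (fromℕ-mono-≤ p)

  1≰0 : ¬ 1# ≤ 0#
  1≰0 p = 0≢1 (≤-antisym 0≤1 p)

  fromℕ-suc≰ : ∀ n → ¬ fromℕ (suc n) ≤ fromℕ n
  fromℕ-suc≰ n p = 1≰0 (+-cancelʳ-≤ (fromℕ n) (subst (fromℕ (suc n) ≤_) (sym (+-identityˡ (fromℕ n))) p))

  fromℕ-cancel-≤ : ∀ {m n} → fromℕ m ≤ fromℕ n → m ℕ.≤ n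
  fromℕ-cancel-≤ {m} {n} p with m ℕ.≤? n
  ... | yes q = q
  ... | no ¬q = contradiction (≤-trans (fromℕ-mono-≤ (ℕₚ.≰⇒> ¬q)) p) (fromℕ-suc≰ n)

  ≰⇒≥ : ∀ {x y} → ¬ x ≤ y → y ≤ x
  ≰⇒≥ {x} {y} p with ≤-total x y
  ... | inj₁ q = contradiction q p
  ... | inj₂ q = q

  <⇒≱ : ∀ {x y} → x < y → ¬ y ≤ x
  <⇒≱ (x≤y , x≢y) y≤x = x≢y (≤-antisym x≤y y≤x)

  ≰⇒> : ∀ {x y} → ¬ x ≤ y → y < x
  ≰⇒> p = ≰⇒≥ p , λ y≡x → p (≤-reflexive (sym y≡x))

  ⁻¹-nonNeg : ∀ {x} → 0# < x → 0# ≤ x ⁻¹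
  ⁻¹-nonNeg {x} (0≤x , 0≢x) with ≤-total 0# (x ⁻¹)
  ... | inj₁ p = p
  ... | inj₂ p = contradiction (subst₂ _≤_ (trans (*-comm _ _) (*-inverseʳ x (≢-sym 0≢x))) (zeroˡ x)
                                         (*-monoʳ-≤-nonNeg x 0≤x p)) 1≰0

  ≤-<-trans : ∀ {x y z} → x ≤ y → y < z → x < z
  ≤-<-trans x≤y y<z@(y≤z , _) = ≤-trans x≤y y≤z , λ { refl → <⇒≱ y<z x≤y }

  x+y-x≡y : ∀ x y → x + y - x ≡ y
  x+y-x≡y = solve 2 (λ x y → x :+ y :- x := y) refl

  fromℕ-pos : ∀ {n} → 0 ℕ.< n → 0# < fromℕ n
  fromℕ-pos {n} 0<n = 0≤fromℕ n , λ 0≡n → ℕₚ.<⇒≱ 0<n (fromℕ-cancel-≤ (≤-reflexive (sym 0≡n)))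

  *-cancelʳ-≤ : ∀ {x y} z → 0# < z → x * z ≤ y * z → x ≤ y
  *-cancelʳ-≤ {x} {y} z 0<z@(_ , 0≢z) xz≤yz = subst₂ _≤_ (unscale x) (unscale y) (*-monoʳ-≤-nonNeg (z ⁻¹) (⁻¹-nonNeg 0<z) xz≤yz)
    where
    unscale : ∀ x → x * z * z ⁻¹ ≡ x
    unscale x = trans (*-assoc _ _ _) (trans (cong (x *_) (*-inverseʳ z (≢-sym 0≢z))) (*-identityʳ x))

  /-cancel : ∀ x y → 0# < y → x / y * y ≡ x
  /-cancel x y (_ , 0≢y) = trans (*-assoc _ _ _) (trans (cong (x *_) (trans (*-comm _ _) (*-inverseʳ y (≢-sym 0≢y)))) (*-identityʳ x))

-- Counting in finite sets of robots.

Disjoint : ∀ {n} → Subset n → Subset n → Set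
Disjoint p q = ∀ {i} → i ∈ p → i ∉ q

∣p∪q∣+∣p∩q∣≡∣p∣+∣q∣ : ∀ {n} (p q : Subset n) → ∣ p ∪ q ∣ ℕ.+ ∣ p ∩ q ∣ ≡ ∣ p ∣ ℕ.+ ∣ q ∣
∣p∪q∣+∣p∩q∣≡∣p∣+∣q∣ []            []            = refl
∣p∪q∣+∣p∩q∣≡∣p∣+∣q∣ (outside ∷ p) (outside ∷ q) = ∣p∪q∣+∣p∩q∣≡∣p∣+∣q∣ p q
∣p∪q∣+∣p∩q∣≡∣p∣+∣q∣ (inside  ∷ p) (outside ∷ q) = cong suc (∣p∪q∣+∣p∩q∣≡∣p∣+∣q∣ p q)
∣p∪q∣+∣p∩q∣≡∣p∣+∣q∣ (outside ∷ p) (inside  ∷ q) =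
  trans (cong suc (∣p∪q∣+∣p∩q∣≡∣p∣+∣q∣ p q)) (sym (ℕₚ.+-suc _ _))
∣p∪q∣+∣p∩q∣≡∣p∣+∣q∣ (inside  ∷ p) (inside  ∷ q) =
  cong suc (trans (ℕₚ.+-suc _ _) (trans (cong suc (∣p∪q∣+∣p∩q∣≡∣p∣+∣q∣ p q)) (sym (ℕₚ.+-suc _ _))))

disjoint⇒∣p∪q∣≡∣p∣+∣q∣ : ∀ {n} (p q : Subset n) → Disjoint p q → ∣ p ∪ q ∣ ≡ ∣ p ∣ ℕ.+ ∣ q ∣
disjoint⇒∣p∪q∣≡∣p∣+∣q∣ {n} p q p#q =
  trans (sym (ℕₚ.+-identityʳ _)) (trans (cong (∣ p ∪ q ∣ ℕ.+_) (sym ∣p∩q∣≡0)) (∣p∪q∣+∣p∩q∣≡∣p∣+∣q∣ p q))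
  where
  ∣p∩q∣≡0 : ∣ p ∩ q ∣ ≡ 0
  ∣p∩q∣≡0 = trans (cong ∣_∣ (Empty-unique λ (i , i∈) → p#q (proj₁ (x∈p∩q⁻ p q i∈)) (proj₂ (x∈p∩q⁻ p q i∈))))
                  (∣⊥∣≡0 n)

∣p∪q∣≤∣p∣+∣q∣ : ∀ {n} (p q : Subset n) → ∣ p ∪ q ∣ ℕ.≤ ∣ p ∣ ℕ.+ ∣ q ∣
∣p∪q∣≤∣p∣+∣q∣ p q = ℕₚ.m+n≤o⇒m≤o _ (ℕₚ.≤-reflexive (∣p∪q∣+∣p∩q∣≡∣p∣+∣q∣ p q))

disjoint-cover : ∀ {n} (g d p q : Subset n) → Disjoint g d → d ⊆ q →
                 (∀ {i} → i ∈ g → i ∈ p ⊎ i ∈ q) → ∣ g ∣ ℕ.+ ∣ d ∣ ℕ.≤ ∣ p ∪ q ∣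
disjoint-cover g d p q g#d d⊆q g⊆ =
  subst (ℕ._≤ ∣ p ∪ q ∣) (disjoint⇒∣p∪q∣≡∣p∣+∣q∣ g d g#d) (p⊆q⇒∣p∣≤∣q∣ cover)
  where
  cover : g ∪ d ⊆ p ∪ q
  cover i∈ with x∈p∪q⁻ g d i∈
  ... | inj₁ i∈g = x∈p∪q⁺ (g⊆ i∈g)
  ... | inj₂ i∈d = x∈p∪q⁺ (inj₂ (d⊆q i∈d))

-- Inclusion-exclusion: `g` and `d` lie in the union, and `d` also lies in the intersection, so it
-- counts twice. With `p` and `q` the faulty sets of two scenarios, this yields the factor 2 in the
-- voting conditions of `Plan`.
disjoint-double-cover : ∀ {n} (g d p q : Subset n) → Disjoint g d → d ⊆ p → d ⊆ q →
                        (∀ {i} → i ∈ g → i ∈ p ⊎ i ∈ q) → ∣ g ∣ ℕ.+ 2 ℕ.* ∣ d ∣ ℕ.≤ ∣ p ∣ ℕ.+ ∣ q ∣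
disjoint-double-cover g d p q g#d d⊆p d⊆q g⊆ = begin
  ∣ g ∣ ℕ.+ 2 ℕ.* ∣ d ∣           ≡⟨ cong (λ k → ∣ g ∣ ℕ.+ (∣ d ∣ ℕ.+ k)) (ℕₚ.+-identityʳ ∣ d ∣) ⟩
  ∣ g ∣ ℕ.+ (∣ d ∣ ℕ.+ ∣ d ∣)     ≡⟨ sym (ℕₚ.+-assoc ∣ g ∣ _ _) ⟩
  ∣ g ∣ ℕ.+ ∣ d ∣ ℕ.+ ∣ d ∣       ≤⟨ ℕₚ.+-mono-≤ (disjoint-cover g d p q g#d d⊆q g⊆)
                                     (p⊆q⇒∣p∣≤∣q∣ λ i∈d → x∈p∩q⁺ (d⊆p i∈d , d⊆q i∈d)) ⟩
  ∣ p ∪ q ∣ ℕ.+ ∣ p ∩ q ∣         ≡⟨ ∣p∪q∣+∣p∩q∣≡∣p∣+∣q∣ p q ⟩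
  ∣ p ∣ ℕ.+ ∣ q ∣                 ∎
  where open ℕₚ.≤-Reasoning

-- A canonical choice of `k` members, provided that there are so many; all robots agree on it, and
-- the sizes of groups become exact.
take : ∀ {n} → ℕ → Subset n → Subset n
take k       []            = []
take k       (outside ∷ p) = outside ∷ take k p
take zero    (inside  ∷ p) = outside ∷ take zero p
take (suc k) (inside  ∷ p) = inside ∷ take k p

take⊆ : ∀ {n} k (p : Subset n) → take k p ⊆ p
take⊆ k       (outside ∷ p) (there i∈) = there (take⊆ k p i∈)
take⊆ zero    (inside  ∷ p) (there i∈) = there (take⊆ zero p i∈)
take⊆ (suc k) (inside  ∷ p) here       = here
take⊆ (suc k) (inside  ∷ p) (there i∈) = there (take⊆ k p i∈)

∣take∣ : ∀ {n} k (p : Subset n) → k ℕ.≤ ∣ p ∣ → ∣ take k p ∣ ≡ k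
∣take∣ zero    []            _         = refl
∣take∣ k       (outside ∷ p) k≤        = ∣take∣ k p k≤
∣take∣ zero    (inside  ∷ p) _         = ∣take∣ zero p ℕ.z≤n
∣take∣ (suc k) (inside  ∷ p) (ℕ.s≤s k≤) = cong suc (∣take∣ k p k≤)

-- The two sides and the numerical plans of a search.

data Side : Set where
  left right : Side

opposite : Side → Side
opposite left  = right
opposite right = left

sides : ∀ s s′ → s′ ≡ s ⊎ s′ ≡ opposite s
sides left  left  = inj₁ refl
sides left  right = inj₂ refl
sides right left  = inj₂ refl
sides right right = inj₁ refl

-- r restarts are left, each group has h robots, and d robots are liars unless the
-- target is at a location claimed before.  From a (or b) supporters on, a claim is
-- serious; the conditions say that a claim of the target is always serious, and
-- that the following robots outvote the faulty ones:
-- * step: the group that made the claim and the h′ robots then sent towards it;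
-- * final: the robots outside the opposite group, and, if the claim is false, the
--   opposite group.
data Plan (n f : ℕ) : (r h d : ℕ) → Set where
  final : ∀ {h d} b → 0 ℕ.< b → b ℕ.+ f ℕ.≤ h ℕ.+ d →
          2 ℕ.* f ℕ.+ h ℕ.< n ℕ.+ d → 2 ℕ.* f ℕ.< h ℕ.+ 2 ℕ.* (d ℕ.+ b) →
          Plan n f 0 h d
  step  : ∀ {r h d} a h′ → 0 ℕ.< a → a ℕ.+ f ℕ.≤ h ℕ.+ d →
          h′ ℕ.≤ h → d ℕ.+ a ℕ.+ h′ ℕ.+ h′ ℕ.≤ n → 2 ℕ.* f ℕ.< h ℕ.+ h′ ℕ.+ 2 ℕ.* d →
          Plan n f r h′ (d ℕ.+ a) → Plan n f (suc r) h d

threshold : ∀ {n f r h d} → Plan n f r h d → ℕ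
threshold (final b _ _ _ _)       = b
threshold (step a _ _ _ _ _ _ _) = a

0<threshold : ∀ {n f r h d} (P : Plan n f r h d) → 0 ℕ.< threshold P
0<threshold (final _ 0<b _ _ _)       = 0<b
0<threshold (step _ _ 0<a _ _ _ _ _) = 0<a

threshold-≤ : ∀ {n f r h d} (P : Plan n f r h d) → threshold P ℕ.+ f ℕ.≤ h ℕ.+ d
threshold-≤ (final _ _ b≤ _ _)       = b≤
threshold-≤ (step _ _ _ a≤ _ _ _ _) = a≤

-- A plan whose numbers are counted in units of z, up to additive constants.
data Schedule (p q : ℕ) : (r h d : ℕ) → Set where
  final : ∀ {h d} b {_ : T (b ℕ.+ p ≤ᵇ h ℕ.+ d)} {_ : T (2 ℕ.* p ℕ.+ h ≤ᵇ q ℕ.+ d)}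
          {_ : T (2 ℕ.* p ≤ᵇ h ℕ.+ 2 ℕ.* (d ℕ.+ b))} → Schedule p q 0 h d
  step  : ∀ {r h d} a h′ {_ : T (0 <ᵇ a)} {_ : T (a ℕ.+ p ≤ᵇ h ℕ.+ d)} {_ : T (h′ ≤ᵇ h)}
          {_ : T (d ℕ.+ a ℕ.+ h′ ℕ.+ h′ ≤ᵇ q)} {_ : T (2 ℕ.* p ≤ᵇ h ℕ.+ h′ ℕ.+ 2 ℕ.* d)} →
          Schedule p q r h′ (d ℕ.+ a) → Schedule p q (suc r) h d

module _ {p q f n z : ℕ} (0<z : 0 ℕ.< z) (f≤pz : f ℕ.≤ p ℕ.* z) (qz+4≤n : q ℕ.* z ℕ.+ 4 ℕ.≤ n) where
  open ℕₚ.≤-Reasoning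

  private
    scale : ∀ {k l} → T (k ≤ᵇ l) → k ℕ.* z ℕ.≤ l ℕ.* z
    scale {k} {l} k≤l = ℕₚ.*-monoˡ-≤ z (ℕₚ.≤ᵇ⇒≤ k l k≤l)

    2f≤2pz : 2 ℕ.* f ℕ.≤ 2 ℕ.* p ℕ.* z
    2f≤2pz = ℕₚ.≤-trans (ℕₚ.*-monoʳ-≤ 2 f≤pz) (ℕₚ.≤-reflexive (sym (ℕₚ.*-assoc 2 p z)))

  -- The weak inequalities of a schedule become the strict ones of a plan through the constants:
  -- every group gets 2 additional robots and the last threshold 1 more. The 4 robots beyond `q`
  -- units pay for the two enlarged groups.
  schedule⇒plan : ∀ {r h d} → Schedule p q r h d → Plan n f r (h ℕ.* z ℕ.+ 2) (d ℕ.* z)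
  schedule⇒plan {h = h} {d} (final b {b+p≤} {2p+h≤} {2p≤}) = final (b ℕ.* z ℕ.+ 1)
    (ℕₚ.m≤n+m 1 (b ℕ.* z))
    (begin
      b ℕ.* z ℕ.+ 1 ℕ.+ f                      ≤⟨ ℕₚ.+-monoʳ-≤ (b ℕ.* z ℕ.+ 1) f≤pz ⟩
      b ℕ.* z ℕ.+ 1 ℕ.+ p ℕ.* z                ≡⟨ e₁ b p z ⟩
      (b ℕ.+ p) ℕ.* z ℕ.+ 1                    ≤⟨ ℕₚ.+-mono-≤ (scale {b ℕ.+ p} {h ℕ.+ d} b+p≤) (ℕₚ.n≤1+n 1) ⟩
      (h ℕ.+ d) ℕ.* z ℕ.+ 2                    ≡⟨ e₂ h d z ⟩
      h ℕ.* z ℕ.+ 2 ℕ.+ d ℕ.* z                ∎)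
    (begin-strict
      2 ℕ.* f ℕ.+ (h ℕ.* z ℕ.+ 2)              ≤⟨ ℕₚ.+-monoˡ-≤ (h ℕ.* z ℕ.+ 2) 2f≤2pz ⟩
      2 ℕ.* p ℕ.* z ℕ.+ (h ℕ.* z ℕ.+ 2)        ≡⟨ e₃ p h z ⟩
      (2 ℕ.* p ℕ.+ h) ℕ.* z ℕ.+ 2              <⟨ ℕₚ.+-mono-≤-< (scale {2 ℕ.* p ℕ.+ h} {q ℕ.+ d} 2p+h≤) (ℕₚ.m<m+n 2 {2} (ℕ.s≤s ℕ.z≤n)) ⟩
      (q ℕ.+ d) ℕ.* z ℕ.+ 4                    ≡⟨ e₄ q d z ⟩
      q ℕ.* z ℕ.+ 4 ℕ.+ d ℕ.* z                ≤⟨ ℕₚ.+-monoˡ-≤ (d ℕ.* z) qz+4≤n ⟩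
      n ℕ.+ d ℕ.* z                            ∎)
    (begin-strict
      2 ℕ.* f                                  ≤⟨ 2f≤2pz ⟩
      2 ℕ.* p ℕ.* z                            ≤⟨ scale {2 ℕ.* p} {h ℕ.+ 2 ℕ.* (d ℕ.+ b)} 2p≤ ⟩
      (h ℕ.+ 2 ℕ.* (d ℕ.+ b)) ℕ.* z            <⟨ ℕₚ.m<m+n _ {4} (ℕ.s≤s ℕ.z≤n) ⟩
      (h ℕ.+ 2 ℕ.* (d ℕ.+ b)) ℕ.* z ℕ.+ 4      ≡⟨ e₅ h d b z ⟩
      h ℕ.* z ℕ.+ 2 ℕ.+ 2 ℕ.* (d ℕ.* z ℕ.+ (b ℕ.* z ℕ.+ 1)) ∎)
    where
    e₁ : ∀ b p z → b ℕ.* z ℕ.+ 1 ℕ.+ p ℕ.* z ≡ (b ℕ.+ p) ℕ.* z ℕ.+ 1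
    e₁ = ℕ-solve-∀
    e₂ : ∀ h d z → (h ℕ.+ d) ℕ.* z ℕ.+ 2 ≡ h ℕ.* z ℕ.+ 2 ℕ.+ d ℕ.* z
    e₂ = ℕ-solve-∀
    e₃ : ∀ p h z → 2 ℕ.* p ℕ.* z ℕ.+ (h ℕ.* z ℕ.+ 2) ≡ (2 ℕ.* p ℕ.+ h) ℕ.* z ℕ.+ 2
    e₃ = ℕ-solve-∀
    e₄ : ∀ q d z → (q ℕ.+ d) ℕ.* z ℕ.+ 4 ≡ q ℕ.* z ℕ.+ 4 ℕ.+ d ℕ.* z
    e₄ = ℕ-solve-∀
    e₅ : ∀ h d b z → (h ℕ.+ 2 ℕ.* (d ℕ.+ b)) ℕ.* z ℕ.+ 4 ≡
                     h ℕ.* z ℕ.+ 2 ℕ.+ 2 ℕ.* (d ℕ.* z ℕ.+ (b ℕ.* z ℕ.+ 1))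
    e₅ = ℕ-solve-∀
  schedule⇒plan {suc r} {h} {d} (step a h′ {0<a} {a+p≤} {h′≤h} {room} {2p≤} s) = step (a ℕ.* z) (h′ ℕ.* z ℕ.+ 2)
    (ℕₚ.*-mono-≤ (ℕₚ.<ᵇ⇒< 0 a 0<a) 0<z)
    (begin
      a ℕ.* z ℕ.+ f                            ≤⟨ ℕₚ.+-monoʳ-≤ (a ℕ.* z) f≤pz ⟩
      a ℕ.* z ℕ.+ p ℕ.* z                      ≡⟨ sym (ℕₚ.*-distribʳ-+ z a p) ⟩
      (a ℕ.+ p) ℕ.* z                          ≤⟨ scale {a ℕ.+ p} {h ℕ.+ d} a+p≤ ⟩
      (h ℕ.+ d) ℕ.* z                          ≤⟨ ℕₚ.m≤m+n _ 2 ⟩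
      (h ℕ.+ d) ℕ.* z ℕ.+ 2                    ≡⟨ e₁ h d z ⟩
      h ℕ.* z ℕ.+ 2 ℕ.+ d ℕ.* z                ∎)
    (ℕₚ.+-monoˡ-≤ 2 (scale {h′} {h} h′≤h))
    (begin
      d ℕ.* z ℕ.+ a ℕ.* z ℕ.+ (h′ ℕ.* z ℕ.+ 2) ℕ.+ (h′ ℕ.* z ℕ.+ 2)  ≡⟨ e₂ d a h′ z ⟩
      (d ℕ.+ a ℕ.+ h′ ℕ.+ h′) ℕ.* z ℕ.+ 4      ≤⟨ ℕₚ.+-monoˡ-≤ 4 (scale {d ℕ.+ a ℕ.+ h′ ℕ.+ h′} {q} room) ⟩
      q ℕ.* z ℕ.+ 4                            ≤⟨ qz+4≤n ⟩
      n                                        ∎)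
    (begin-strict
      2 ℕ.* f                                  ≤⟨ 2f≤2pz ⟩
      2 ℕ.* p ℕ.* z                            ≤⟨ scale {2 ℕ.* p} {h ℕ.+ h′ ℕ.+ 2 ℕ.* d} 2p≤ ⟩
      (h ℕ.+ h′ ℕ.+ 2 ℕ.* d) ℕ.* z             <⟨ ℕₚ.m<m+n _ {4} (ℕ.s≤s ℕ.z≤n) ⟩
      (h ℕ.+ h′ ℕ.+ 2 ℕ.* d) ℕ.* z ℕ.+ 4       ≡⟨ e₃ h h′ d z ⟩
      h ℕ.* z ℕ.+ 2 ℕ.+ (h′ ℕ.* z ℕ.+ 2) ℕ.+ 2 ℕ.* (d ℕ.* z) ∎)
    (subst (Plan n f r (h′ ℕ.* z ℕ.+ 2)) (ℕₚ.*-distribʳ-+ z d a) (schedule⇒plan s))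
    where
    e₁ : ∀ h d z → (h ℕ.+ d) ℕ.* z ℕ.+ 2 ≡ h ℕ.* z ℕ.+ 2 ℕ.+ d ℕ.* z
    e₁ = ℕ-solve-∀
    e₂ : ∀ d a h z → d ℕ.* z ℕ.+ a ℕ.* z ℕ.+ (h ℕ.* z ℕ.+ 2) ℕ.+ (h ℕ.* z ℕ.+ 2) ≡ (d ℕ.+ a ℕ.+ h ℕ.+ h) ℕ.* z ℕ.+ 4
    e₂ = ℕ-solve-∀
    e₃ : ∀ h g d z → (h ℕ.+ g ℕ.+ 2 ℕ.* d) ℕ.* z ℕ.+ 4 ≡ h ℕ.* z ℕ.+ 2 ℕ.+ (g ℕ.* z ℕ.+ 2) ℕ.+ 2 ℕ.* (d ℕ.* z)
    e₃ = ℕ-solve-∀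

-- Classical choice, comprehension and least elements.

module LineSearch (em : ExcludedMiddle 0ℓ) (R : CompleteOrderedField) where
  open CompleteOrderedField R
  open RealArithmetic R
  open Search R

  decideBy : ∀ {A B : Set} {P : A → Set} → Dec (∃ P) → (A → B) → B → B
  decideBy (yes (x , _)) f b = f x
  decideBy (no _)        f b = b

  -- The witness delivered by excluded middle is arbitrary; uniqueness makes the value independent
  -- of it.
  decideBy-yes : ∀ {A B : Set} {P : A → Set} (p? : Dec (∃ P)) {f : A → B} {b : B} {x} →
                 (∀ {x y} → P x → P y → x ≡ y) → P x → decideBy p? f b ≡ f x
  decideBy-yes (yes (_ , py)) {f} unique px = cong f (unique py px)
  decideBy-yes (no ¬p)            unique px = contradiction (-, px) ¬p

  ⟪_⟫ : ∀ {n} → (Fin n → Set) → Subset n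
  ⟪ P ⟫ = tabulate λ i → does (em {P i})

  ∈⟪⟫⁺ : ∀ {n} {P : Fin n → Set} {i} → P i → i ∈ ⟪ P ⟫
  ∈⟪⟫⁺ {P = P} {i} p = lookup⇒[]= i ⟪ P ⟫ (trans (lookup∘tabulate _ i) (dec-true em p))

  ∈⟪⟫⁻ : ∀ {n} {P : Fin n → Set} {i} → i ∈ ⟪ P ⟫ → P i
  ∈⟪⟫⁻ {P = P} {i} i∈ with em {P i} | trans (sym (lookup∘tabulate (λ i → does (em {P i})) i)) ([]=⇒lookup i∈)
  ... | yes p | _ = p

  ⟪⟫-cong : ∀ {n} {P Q : Fin n → Set} → (∀ {i} → P i → Q i) → (∀ {i} → Q i → P i) → ⟪ P ⟫ ≡ ⟪ Q ⟫
  ⟪⟫-cong {P = P} {Q} P⇒Q Q⇒P = tabulate-cong λ i → does-≡ (em {P i}) (em {Q i})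
    where
    does-≡ : ∀ {i} (p? : Dec (P i)) (q? : Dec (Q i)) → does p? ≡ does q?
    does-≡ (yes p) q? = sym (dec-true q? (P⇒Q p))
    does-≡ (no ¬p) q? = sym (dec-false q? (¬p ∘ Q⇒P))

  -- `P` attaches at most one real to each index, so `Q` holds for at most `n` reals. The induction
  -- splits off the real attached to index `zero` and compares it with the least of the others.
  ∃-least : ∀ {n} (P : Fin n → ℝ → Set) (Q : ℝ → Set) → (∀ {i y z} → P i y → P i z → y ≡ z) →
            (∀ {y} → Q y → ∃[ i ] P i y) → ∀ {y} → Q y → ∃[ y ] (Q y × (∀ {z} → Q z → y ≤ z))
  ∃-least {zero}  P Q P-functional Q⇒P q with () ← proj₁ (Q⇒P q)
  ∃-least {suc n} P Q P-functional Q⇒P q with em {∃[ y ] (Q y × P zero y)} | em {∃[ y ] (Q y × ¬ P zero y)}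
  ... | yes (y , qy , py) | no none = y , qy , below
    where
    below : ∀ {z} → Q z → y ≤ z
    below {z} qz with em {P zero z}
    ... | yes pz = ≤-reflexive (P-functional py pz)
    ... | no ¬pz = contradiction (z , qz , ¬pz) none
  ... | no none | no none′ = contradiction (-, q , λ p → none (-, q , p)) none′
  ... | first? | yes (z , qz , ¬pz) = combine first? (∃-least (P ∘ suc) Q′ P-functional Q′⇒P (qz , ¬pz))
    where
    Q′ : ℝ → Set
    Q′ y = Q y × ¬ P zero y
    Q′⇒P : ∀ {y} → Q′ y → ∃[ i ] P (suc i) y
    Q′⇒P (qy , ¬py) with Q⇒P qy
    ... | zero  , py = contradiction py ¬py
    ... | suc i , py = i , py
    combine : Dec (∃[ y ] (Q y × P zero y)) → ∃[ y ] (Q′ y × (∀ {z} → Q′ z → y ≤ z)) →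
              ∃[ y ] (Q y × (∀ {z} → Q z → y ≤ z))
    combine (no none) (y , (qy , _) , least) = y , qy , λ qz → least (qz , λ pz → none (-, qz , pz))
    combine (yes (x , qx , px)) (y , (qy , _) , least) with ≤-total x y
    ... | inj₁ x≤y = x , qx , below
      where
      below : ∀ {z} → Q z → x ≤ z
      below {z} qz with em {P zero z}
      ... | yes pz = ≤-reflexive (P-functional px pz)
      ... | no ¬pz = ≤-trans x≤y (least (qz , ¬pz))
    ... | inj₂ y≤x = y , qy , below
      where
      below : ∀ {z} → Q z → y ≤ z
      below {z} qz with em {P zero z}
      ... | yes pz = ≤-trans y≤x (≤-reflexive (P-functional px pz))
      ... | no ¬pz = least (qz , ¬pz)

  -- Motions of speed at most 1 and their concatenation.

  Lipschitz : (ℝ → ℝ) → Set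
  Lipschitz p = ∀ {s t} → s ≤ t → p t - p s ≤ t - s × p s - p t ≤ t - s

  glue : ℝ → (ℝ → ℝ) → (ℝ → ℝ) → ℝ → ℝ
  glue b p q t with em {t ≤ b}
  ... | yes _ = p t
  ... | no  _ = q t

  glue-≤ : ∀ {b t} p q → t ≤ b → glue b p q t ≡ p t
  glue-≤ {b} {t} p q t≤b with em {t ≤ b}
  ... | yes _  = refl
  ... | no t≰b = contradiction t≤b t≰b

  glue-≥ : ∀ {b t} p q → p b ≡ q b → b ≤ t → glue b p q t ≡ q t
  glue-≥ {b} {t} p q pb≡qb b≤t with em {t ≤ b}
  ... | no _    = refl
  ... | yes t≤b with refl ← ≤-antisym t≤b b≤t = pb≡qb

  glue-lipschitz : ∀ {b p q} → Lipschitz p → Lipschitz q → p b ≡ q b → Lipschitz (glue b p q)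
  glue-lipschitz {b} {p} {q} p-lip q-lip pb≡qb {s} {t} s≤t with em {s ≤ b} | em {t ≤ b}
  ... | yes _   | yes _   = p-lip s≤t
  ... | no s≰b  | yes t≤b = contradiction (≤-trans s≤t t≤b) s≰b
  ... | no _    | no _    = q-lip s≤t
  -- The junction `b` lies between the two times: the bounds before and after `b` add up.
  ... | yes s≤b | no t≰b  =
      subst₂ _≤_ (telescope _ _ _) (telescope _ _ _)
        (+-mono-≤ (proj₁ (q-lip (≰⇒≥ t≰b))) (subst (λ x → x - p s ≤ b - s) pb≡qb (proj₁ (p-lip s≤b))))
    , subst₂ _≤_ (telescope _ _ _) (trans (+-comm (b - s) (t - b)) (telescope _ _ _))
        (+-mono-≤ (subst (λ x → p s - x ≤ b - s) pb≡qb (proj₂ (p-lip s≤b))) (proj₂ (q-lip (≰⇒≥ t≰b))))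
    where
    telescope : ∀ x y z → x - y + (y - z) ≡ x - z
    telescope = solve 3 (λ x y z → x :- y :+ (y :- z) := x :- z) refl

  signed : Side → ℝ → ℝ
  signed right x = x
  signed left  x = - x

  displacement : Maybe Side → ℝ → ℝ
  displacement (just s) x = signed s x
  displacement nothing  x = 0#

  displacement-0 : ∀ v → displacement v 0# ≡ 0#
  displacement-0 (just right) = refl
  displacement-0 (just left)  = -0#≈0#
  displacement-0 nothing      = refl

  displacement-lipschitz : ∀ {p} v → Lipschitz p → Lipschitz (displacement v ∘ p)
  displacement-lipschitz (just right) p-lip s≤t = p-lip s≤t
  displacement-lipschitz {p} (just left) p-lip {s} {t} s≤t =
    subst (_≤ t - s) (swap (p s) (p t)) (proj₂ (p-lip s≤t)) ,
    subst (_≤ t - s) (swap (p t) (p s)) (proj₁ (p-lip s≤t))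
    where swap : ∀ x y → x - y ≡ - y - - x
          swap = solve 2 (λ x y → x :- y := :- y :- :- x) refl
  displacement-lipschitz nothing      p-lip s≤t = 0≤ , 0≤
    where 0≤ = subst (_≤ _) (sym (-‿inverseʳ 0#)) (x≤y⇒0≤y-x s≤t)

  outward-lipschitz : ∀ S → Lipschitz (_- S)
  outward-lipschitz S {s} {t} s≤t =
    ≤-reflexive (shift s t S) , ≤-trans (≤-reflexive (shift t s S)) (≤-trans s-t≤0 (x≤y⇒0≤y-x s≤t))
    where
    shift : ∀ s t S → t - S - (s - S) ≡ t - s
    shift = solve 3 (λ s t S → t :- S :- (s :- S) := t :- s) refl
    s-t≤0 : s - t ≤ 0#
    s-t≤0 = subst (s - t ≤_) (-‿inverseʳ t) (+-monoˡ-≤ (- t) s≤t)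

  inward-lipschitz : ∀ S → Lipschitz (λ t → S - t)
  inward-lipschitz S {s} {t} s≤t = subst₂ _≤_ (shift S t s) refl (proj₂ (outward-lipschitz S s≤t))
                                 , subst₂ _≤_ (shift S s t) refl (proj₁ (outward-lipschitz S s≤t))
    where
    shift : ∀ S s t → t - S - (s - S) ≡ S - s - (S - t)
    shift = solve 3 (λ S s t → t :- S :- (s :- S) := S :- s :- (S :- t)) refl

  -- All robots are at the origin at time start.  Those in neither group wait there.
  -- Unclaimed locations nearer than visited have been excluded.
  record State (n : ℕ) : Set where
    field
      start   : ℝ
      visited : ℝ
      group   : Side → Subset n
      liars   : Subset n

    heading : Fin n → Maybe Side
    heading i with i ∈? group right | i ∈? group left
    ... | yes _ | _     = just right
    ... | no _  | yes _ = just left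
    ... | no _  | no _  = nothing
  open State

  -- Claims and the first serious claim of a sweep.

  module _ {n : ℕ} where

    -- A robot that has announced two locations is faulty and is ignored.  So each
    -- robot has at most one location that counts, although it may announce at
    -- infinitely many times and have no first message.
    Claims : Transcript n → ℝ → ℝ → Fin n → Set
    Claims H T ℓ i = (∃[ t ] (0# ≤ t × t ≤ T × H i t ≡ just ℓ)) ×
                     (∀ {t ℓ′} → 0# ≤ t → t ≤ T → H i t ≡ just ℓ′ → ℓ′ ≡ ℓ)

    -- A claim at distance `y` is judged at time `start σ + y`, when the sweeping group arrives
    -- there; no later message affects the verdict.
    claimants : Transcript n → State n → Side → ℝ → Subset n
    claimants H σ s y = ⟪ (λ i → i ∈ group σ s × Claims H (start σ + y) (signed s y) i) ⟫

    -- Claims nearer than `visited` are left aside, so that a new sweep is undisturbed until it has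
    -- reached the previous claim again.
    Serious : Transcript n → State n → ℕ → Side → ℝ → Set
    Serious H σ a s y = 0# ≤ y × visited σ ≤ y × a ℕ.≤ ∣ claimants H σ s y ∣

    -- Both sides may have a serious claim at the same distance; the tie goes to the right, which
    -- makes the first claim unique.
    First : Transcript n → State n → ℕ → Side × ℝ → Set
    First H σ a (s , y) = Serious H σ a s y × (∀ {s′ y′} → Serious H σ a s′ y′ → y ≤ y′) ×
                          (s ≡ left → ¬ Serious H σ a right y)

    First-unique : ∀ {H σ a e e′} → First H σ a e → First H σ a e′ → e ≡ e′
    First-unique {H} {σ} {a} {s , y} {s′ , _} (serious , least , tie) (serious′ , least′ , tie′)
      with refl ← ≤-antisym (least serious′) (least′ serious) = cong (_, y) (same s s′ serious serious′ tie tie′)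
      where
      same : ∀ s s′ → Serious H σ a s y → Serious H σ a s′ y → (s ≡ left → ¬ Serious H σ a right y) →
             (s′ ≡ left → ¬ Serious H σ a right y) → s ≡ s′
      same left  left  _ _ _ _ = refl
      same right right _ _ _ _ = refl
      same left  right _ q t _ = contradiction q (t refl)
      same right left  p _ _ t = contradiction p (t refl)

    AgreeUpTo-mono : ∀ {T T′} {H H′ : Transcript n} → T′ ≤ T → AgreeUpTo T H H′ → AgreeUpTo T′ H H′
    AgreeUpTo-mono T′≤T agree i t 0≤t t≤T′ = agree i t 0≤t (≤-trans t≤T′ T′≤T)

    AgreeUpTo-sym : ∀ {T} {H H′ : Transcript n} → AgreeUpTo T H H′ → AgreeUpTo T H′ H
    AgreeUpTo-sym agree i t 0≤t t≤T = sym (agree i t 0≤t t≤T)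

    Claims-cong : ∀ {H H′ T ℓ i} → AgreeUpTo T H H′ → Claims H T ℓ i → Claims H′ T ℓ i
    Claims-cong agree ((t , 0≤t , t≤T , Ht≡ℓ) , only) =
      (t , 0≤t , t≤T , trans (sym (agree _ t 0≤t t≤T)) Ht≡ℓ) ,
      λ 0≤t t≤T H′t≡ℓ′ → only 0≤t t≤T (trans (agree _ _ 0≤t t≤T) H′t≡ℓ′)

    claimants-cong : ∀ {H H′} σ s y → AgreeUpTo (start σ + y) H H′ → claimants H σ s y ≡ claimants H′ σ s y
    claimants-cong σ s y agree = ⟪⟫-cong (λ (i∈ , c) → i∈ , Claims-cong agree c)
                                         (λ (i∈ , c) → i∈ , Claims-cong (AgreeUpTo-sym agree) c)

    Serious-cong : ∀ {H H′} σ {a s y} → AgreeUpTo (start σ + y) H H′ → Serious H σ a s y → Serious H′ σ a s y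
    Serious-cong σ {a} {s} {y} agree (0≤y , v≤y , a≤) =
      0≤y , v≤y , subst (λ C → a ℕ.≤ ∣ C ∣) (claimants-cong σ s y agree) a≤

    -- A competing claim at distance at most `y` is judged no later than `start σ + y`, hence alike
    -- in both transcripts; one that is farther away cannot come first.
    First-cong : ∀ {H H′} σ {a s y} → AgreeUpTo (start σ + y) H H′ → First H σ a (s , y) → First H′ σ a (s , y)
    First-cong σ {a} {s} {y} agree (serious , least , tie) = Serious-cong σ agree serious , least′ ,
      λ s≡left → tie s≡left ∘ Serious-cong σ (AgreeUpTo-sym agree)
      where
      least′ : ∀ {s′ y′} → Serious _ σ a s′ y′ → y ≤ y′
      least′ {s′} {y′} serious′ with ≤-total y y′
      ... | inj₁ y≤y′ = y≤y′
      ... | inj₂ y′≤y = least (Serious-cong σ (AgreeUpTo-sym (AgreeUpTo-mono (+-monoʳ-≤ _ y′≤y) agree)) serious′)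

    signed-injective : ∀ {s s′ y y′} → 0# ≤ y → 0# ≤ y′ → signed s y ≡ signed s′ y′ → y ≡ y′
    signed-injective {right} {right} _ _ eq = eq
    signed-injective {left}  {left}  _ _ eq = trans (sym (-‿involutive _)) (trans (cong -_ eq) (-‿involutive _))
    signed-injective {right} {left}  0≤y 0≤y′ eq = opposed 0≤y 0≤y′ eq
      where
      opposed : ∀ {y y′} → 0# ≤ y → 0# ≤ y′ → y ≡ - y′ → y ≡ y′
      opposed {y} {y′} 0≤y 0≤y′ eq = trans (≤-antisym y≤0 0≤y) (≤-antisym 0≤y′ y′≤0)
        where
        sum≡0 : y + y′ ≡ 0#
        sum≡0 = trans (cong (_+ y′) eq) (-‿inverseˡ y′)
        y≤0 = subst (y ≤_) sum≡0 (x≤x+y 0≤y′)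
        y′≤0 = subst (y′ ≤_) (trans (+-comm y′ y) sum≡0) (x≤x+y 0≤y)
    signed-injective {left} {right} 0≤y 0≤y′ eq = sym (signed-injective {right} {left} 0≤y′ 0≤y (sym eq))

    -- As `a` is positive, each serious distance has a claimant, and a robot that counts has one
    -- location only. So the serious distances are finite in number, although messages may come at a
    -- continuum of times.
    ∃-First : ∀ {H σ a s y} → 0 ℕ.< a → Serious H σ a s y → ∃ (First H σ a)
    ∃-First {H} {σ} {a} {s} {y} 0<a serious = pick (∃-least P Q functional Q⇒P (s , serious))
      where
      Q : ℝ → Set
      Q y = ∃[ s ] Serious H σ a s y
      P : Fin n → ℝ → Set
      P i y = 0# ≤ y × ∃[ s ] Claims H (start σ + y) (signed s y) i
      functional : ∀ {i y z} → P i y → P i z → y ≡ z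
      -- Of two claims of one robot, the one judged later excludes every other location announced up
      -- to then, in particular that of the earlier claim.
      functional {y = y} {z} (0≤y , s , (t , 0≤t , t≤ , eq) , only) (0≤z , s′ , (t′ , 0≤t′ , t′≤ , eq′) , only′)
        with ≤-total y z
      ... | inj₁ y≤z = signed-injective {s} {s′} 0≤y 0≤z (only′ 0≤t (≤-trans t≤ (+-monoʳ-≤ _ y≤z)) eq)
      ... | inj₂ z≤y = signed-injective {s} {s′} 0≤y 0≤z (sym (only 0≤t′ (≤-trans t′≤ (+-monoʳ-≤ _ z≤y)) eq′))
      Q⇒P : ∀ {y} → Q y → ∃[ i ] P i y
      Q⇒P {y} (s , 0≤y , _ , a≤) with nonempty? (claimants H σ s y)
      ... | yes (i , i∈) = i , 0≤y , s , proj₂ (∈⟪⟫⁻ i∈)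
      ... | no empty = contradiction (ℕₚ.<-≤-trans 0<a (subst (λ C → a ℕ.≤ ∣ C ∣) (Empty-unique empty) a≤))
                                     (ℕₚ.<⇒≱ (ℕ.s≤s (ℕₚ.≤-reflexive (∣⊥∣≡0 n))))
      pick : ∃[ y ] (Q y × (∀ {z} → Q z → y ≤ z)) → ∃ (First H σ a)
      pick (y , (s , serious) , least) with em {Serious H σ a right y}
      ... | yes onRight = (right , y) , onRight , (λ q → least (-, q)) , λ ()
      ... | no ¬onRight = (s , y) , serious , (λ q → least (-, q)) , λ _ → ¬onRight

  -- Restarts and the trajectories prescribed by the algorithm.

  next : ∀ {n} → State n → (a h′ : ℕ) → Side × ℝ → Subset n → State n
  next {n} σ a h′ (s , y) C = record { start = start σ + y + y ; visited = y ; group = regroup ; liars = liars′ }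
    where
    liars′ ahead behind : Subset n
    -- Exactly `a` claimants are added, however many there are, so that the numbers stay those of
    -- the plan.
    liars′ = liars σ ∪ take a C
    -- These robots swept on the other side, so at the claim they are voters distinct from the group
    -- that made it.
    ahead  = take h′ (group σ (opposite s))
    behind = take h′ (∁ (liars′ ∪ ahead))
    regroup : Side → Subset n
    regroup s′ with sides s s′
    ... | inj₁ _ = ahead
    ... | inj₂ _ = behind

  module _ {n : ℕ} where

    outward : State n → Fin n → ℝ → ℝ
    outward σ i t = displacement (heading σ i) (t - start σ)

    -- In the last sweep the groups keep going, while the robots waiting at the origin leave at the
    -- moment of the claim and thus follow its side with delay `y`.
    pursue : State n → Side × ℝ → Maybe Side → ℝ → ℝ
    pursue σ (s , y) (just s′) t = signed s′ (t - start σ)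
    pursue σ (s , y) nothing   t = signed s (t - (start σ + y))

  module _ {n f : ℕ} where

    -- The definition inspects the entire transcript for a first serious claim, yet uses it only
    -- after the time of that claim; `path-causal` makes this precise.
    path  : ∀ {r h d} → Plan n f r h d → State n → Transcript n → Fin n → ℝ → ℝ
    after : ∀ {r h d} → Plan n f r h d → State n → Transcript n → Fin n → Side × ℝ → ℝ → ℝ

    path P σ H i = decideBy (em {∃ (First H σ (threshold P))})
      (λ (s , y) → glue (start σ + y) (outward σ i) (after P σ H i (s , y))) (outward σ i)

    after (final _ _ _ _ _) σ H i e = pursue σ e (heading σ i)
    -- On a restart every robot retraces its way to the origin, arriving `y` after the claim, and
    -- then obeys the rest of the plan.
    after (step a h′ _ _ _ _ _ P) σ H i (s , y) =
      glue (start σ + y + y) (λ t → displacement (heading σ i) (start σ + y + y - t))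
           (path P (next σ a h′ (s , y) (claimants H σ s y)) H i)

    path-First : ∀ {r h d} (P : Plan n f r h d) {σ H s y} i → First H σ (threshold P) (s , y) →
                 path P σ H i ≡ glue (start σ + y) (outward σ i) (after P σ H i (s , y))
    path-First P {σ} {H} i first = decideBy-yes em (First-unique {n} {H} {σ} {threshold P}) first

    path-outward : ∀ {r h d} (P : Plan n f r h d) {σ H} i {t} →
                   (∀ {s y} → First H σ (threshold P) (s , y) → t ≤ start σ + y) →
                   path P σ H i t ≡ outward σ i t
    path-outward P {σ} {H} i undisturbed with em {∃ (First H σ (threshold P))}
    ... | yes (_ , first) = glue-≤ _ _ (undisturbed first)
    ... | no _            = refl

    path-start : ∀ {r h d} (P : Plan n f r h d) {σ H} i → path P σ H i (start σ) ≡ 0#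
    path-start P {σ} i = trans
      (path-outward P i λ ((0≤y , _) , _) → x≤x+y 0≤y)
      (trans (cong (displacement (heading σ i)) (-‿inverseʳ (start σ))) (displacement-0 (heading σ i)))

    after-continuous : ∀ {r h d} (P : Plan n f r h d) {σ H} i {s y} → 0# ≤ y →
                       outward σ i (start σ + y) ≡ after P σ H i (s , y) (start σ + y)
    after-continuous (final _ _ _ _ _) {σ} i {s} {y} 0≤y with heading σ i
    ... | just _  = refl
    ... | nothing = sym (trans (cong (signed s) (-‿inverseʳ (start σ + y))) (displacement-0 (just s)))
    after-continuous (step _ _ _ _ _ _ _ _) {σ} i {s} {y} 0≤y =
      trans (cong (displacement (heading σ i)) (turn (start σ) y)) (sym (glue-≤ _ _ (x≤x+y 0≤y)))
      where
      turn : ∀ S y → S + y - S ≡ S + y + y - (S + y)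
      turn = solve 2 (λ S y → S :+ y :- S := S :+ y :+ y :- (S :+ y)) refl

    restart-continuous : ∀ {r h d} (P : Plan n f r h d) {σ a h′ H i} s y →
      displacement (heading σ i) (start σ + y + y - (start σ + y + y)) ≡
      path P (next σ a h′ (s , y) (claimants H σ s y)) H i (start σ + y + y)
    restart-continuous P {σ} {i = i} s y = trans
      (trans (cong (displacement (heading σ i)) (-‿inverseʳ (start σ + y + y))) (displacement-0 (heading σ i)))
      (sym (path-start P i))

    path-after : ∀ {r h d} (P : Plan n f r h d) {σ H s y} i {t} → First H σ (threshold P) (s , y) →
                 start σ + y ≤ t → path P σ H i t ≡ after P σ H i (s , y) t
    path-after P i {t} first@((0≤y , _) , _) y≤t =
      trans (cong (λ p → p t) (path-First P i first)) (glue-≥ _ _ (after-continuous P i 0≤y) y≤t)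

    path-lipschitz  : ∀ {r h d} (P : Plan n f r h d) {σ H} i → Lipschitz (path P σ H i)
    after-lipschitz : ∀ {r h d} (P : Plan n f r h d) {σ H} i e → Lipschitz (after P σ H i e)

    path-lipschitz P {σ} {H} i with em {∃ (First H σ (threshold P))}
    ... | no _ = displacement-lipschitz (heading σ i) (outward-lipschitz (start σ))
    ... | yes (e , (0≤y , _) , _) =
      glue-lipschitz (displacement-lipschitz (heading σ i) (outward-lipschitz (start σ)))
                     (after-lipschitz P i e) (after-continuous P i 0≤y)

    after-lipschitz (final _ _ _ _ _) {σ} i (s , y) with heading σ i
    ... | just s′ = displacement-lipschitz (just s′) (outward-lipschitz (start σ))
    ... | nothing = displacement-lipschitz (just s) (outward-lipschitz (start σ + y))
    after-lipschitz (step _ _ _ _ _ _ _ P) {σ} i (s , y) =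
      glue-lipschitz (displacement-lipschitz (heading σ i) (inward-lipschitz (start σ + y + y)))
                     (path-lipschitz P i) (restart-continuous P s y)

    -- A first claim influences the position at time `t` only if it comes strictly before `t`.
    -- Agreement before `t` then includes the moment of the claim, so both transcripts have the same
    -- first claim, the same claimants and the same next state.
    path-causal : ∀ {r h d} (P : Plan n f r h d) {σ H H′} i {t} → AgreeBefore t H H′ →
                  path P σ H i t ≡ path P σ H′ i t
    path-causal P {σ} {H} {H′} i {t} agree
      with em {∃[ s ] ∃[ y ] (First H σ (threshold P) (s , y) × ¬ t ≤ start σ + y)}
    ... | no none = trans (path-outward P i (undisturbed none)) (sym (path-outward P i (undisturbed none′)))
      where
      undisturbed : ∀ {H} → ¬ (∃[ s ] ∃[ y ] (First H σ (threshold P) (s , y) × ¬ t ≤ start σ + y)) →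
                    ∀ {s y} → First H σ (threshold P) (s , y) → t ≤ start σ + y
      undisturbed none {s} {y} first with em {t ≤ start σ + y}
      ... | yes t≤ = t≤
      ... | no t≰  = contradiction (s , y , first , t≰) none
      none′ : ¬ (∃[ s ] ∃[ y ] (First H′ σ (threshold P) (s , y) × ¬ t ≤ start σ + y))
      none′ (s , y , first , t≰) = none (s , y , First-cong σ agree′ first , t≰)
        where
        agree′ : AgreeUpTo (start σ + y) H′ H
        agree′ j u 0≤u u≤ = sym (agree j u 0≤u (≤-<-trans u≤ (≰⇒> t≰)))
    ... | yes (s , y , first , t≰) = 
      trans (path-after P i first y≤t) (trans (after-causal P) (sym (path-after P i first′ y≤t)))
      where
      y≤t = ≰⇒≥ t≰
      agree′ : AgreeUpTo (start σ + y) H H′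
      agree′ j u 0≤u u≤ = agree j u 0≤u (≤-<-trans u≤ (≰⇒> t≰))
      first′ = First-cong σ agree′ first
      after-causal : ∀ {r h d} (P : Plan n f r h d) → after P σ H i (s , y) t ≡ after P σ H′ i (s , y) t
      after-causal (final _ _ _ _ _) = refl
      after-causal (step a h′ _ _ _ _ _ P) rewrite claimants-cong σ s y agree′ = cong-glue (path-causal P i agree)
        where
        cong-glue : ∀ {b p q q′} → q t ≡ q′ t → glue b p q t ≡ glue b p q′ t
        cong-glue {b} eq with em {t ≤ b}
        ... | yes _ = refl
        ... | no _  = eq

  -- Invariants of the state and the time allowance.

  record Grouped {n} (h d : ℕ) (σ : State n) : Set where
    field
      ∣group∣        : ∀ s → ∣ group σ s ∣ ≡ h
      ∣liars∣        : ∣ liars σ ∣ ≡ d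
      group-disjoint : ∀ s → Disjoint (group σ s) (group σ (opposite s))
      liars-disjoint : ∀ s → Disjoint (group σ s) (liars σ)

    heading-group : ∀ s {i} → i ∈ group σ s → heading σ i ≡ just s
    heading-group s {i} i∈ with i ∈? group σ right | i ∈? group σ left
    heading-group right i∈ | yes _   | _       = refl
    heading-group right i∈ | no i∉   | _       = contradiction i∈ i∉
    heading-group left  i∈ | yes i∈′ | _       = contradiction i∈′ (group-disjoint left i∈)
    heading-group left  i∈ | no _    | yes _   = refl
    heading-group left  i∈ | no _    | no i∉   = contradiction i∈ i∉

  open Grouped

  heading-none : ∀ {n} (σ : State n) {i} → (∀ s → i ∉ group σ s) → heading σ i ≡ nothing
  heading-none σ {i} i∉ with i ∈? group σ right | i ∈? group σ left
  ... | yes i∈ | _      = contradiction i∈ (i∉ right)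
  ... | no _   | yes i∈ = contradiction i∈ (i∉ left)
  ... | no _   | no _   = refl

  outward-group : ∀ {n h d} {σ : State n} → Grouped h d σ → ∀ s {i} y → i ∈ group σ s →
                  outward σ i (start σ + y) ≡ signed s y
  outward-group {σ = σ} G s y i∈ =
    trans (cong (λ v → displacement v (start σ + y - start σ)) (heading-group G s i∈))
          (cong (signed s) (x+y-x≡y (start σ) y))

  -- Time that suffices for a target at distance `d` when `r` restarts are left. A restart caused by
  -- a claim at `x ≤ d` takes `x + x`; in the last sweep the followers reach the target after
  -- `x + d`.
  need : ℕ → ℝ → ℝ
  need zero    d = d + d
  need (suc r) d = d + d + need r d

  need-≥ : ∀ r {d} → 0# ≤ d → d + d ≤ need r d
  need-≥ zero    0≤d = ≤-refl
  need-≥ (suc r) 0≤d = x≤x+y (≤-trans (+-nonNeg 0≤d 0≤d) (need-≥ r 0≤d))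

  -- `room` leaves `h′` robots outside `liars′` and `ahead` for the group `behind`. The new liars
  -- come from group `s`, which meets neither the old liars nor the opposite group.
  next-grouped : ∀ {n h d} {σ : State n} → Grouped h d σ → ∀ {a h′} s y {C} → h′ ℕ.≤ h → d ℕ.+ a ℕ.+ h′ ℕ.+ h′ ℕ.≤ n →
                 C ⊆ group σ s → a ℕ.≤ ∣ C ∣ → Grouped h′ (d ℕ.+ a) (next σ a h′ (s , y) C)
  next-grouped {n} {h} {d} {σ} G {a} {h′} s y {C} h′≤h room C⊆ a≤ = record
    { ∣group∣        = sizes
    ; ∣liars∣        = ∣liars′∣
    ; group-disjoint = split s
    ; liars-disjoint = apart
    }
    where
    liars′ = liars σ ∪ take a C
    ahead  = take h′ (group σ (opposite s))
    behind = take h′ (∁ (liars′ ∪ ahead))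
    ∣liars′∣ : ∣ liars′ ∣ ≡ d ℕ.+ a
    ∣liars′∣ = trans
      (disjoint⇒∣p∪q∣≡∣p∣+∣q∣ _ _ λ i∈L i∈A → liars-disjoint G s (C⊆ (take⊆ a C i∈A)) i∈L)
      (cong₂ ℕ._+_ (∣liars∣ G) (∣take∣ a C a≤))
    ∣ahead∣ : ∣ ahead ∣ ≡ h′
    ∣ahead∣ = ∣take∣ h′ (group σ (opposite s)) (subst (h′ ℕ.≤_) (sym (∣group∣ G (opposite s))) h′≤h)
    ∣behind∣ : ∣ behind ∣ ≡ h′
    ∣behind∣ = ∣take∣ h′ (∁ (liars′ ∪ ahead)) (subst (h′ ℕ.≤_) (sym (∣∁p∣≡n∸∣p∣ (liars′ ∪ ahead))) (ℕₚ.m+n≤o⇒m≤o∸n h′ (begin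
      h′ ℕ.+ ∣ liars′ ∪ ahead ∣           ≤⟨ ℕₚ.+-monoʳ-≤ h′ (∣p∪q∣≤∣p∣+∣q∣ liars′ ahead) ⟩
      h′ ℕ.+ (∣ liars′ ∣ ℕ.+ ∣ ahead ∣)   ≡⟨ cong (h′ ℕ.+_) (cong₂ ℕ._+_ ∣liars′∣ ∣ahead∣) ⟩
      h′ ℕ.+ (d ℕ.+ a ℕ.+ h′)             ≡⟨ ℕₚ.+-comm h′ _ ⟩
      d ℕ.+ a ℕ.+ h′ ℕ.+ h′               ≤⟨ room ⟩
      n                                   ∎)))
      where open ℕₚ.≤-Reasoning
    ∉behind : ∀ {i} → i ∈ liars′ ∪ ahead → i ∉ behind
    ∉behind i∈ i∈B = x∈∁p⇒x∉p (take⊆ h′ _ i∈B) i∈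
    sizes : ∀ s′ → ∣ group (next σ a h′ (s , y) C) s′ ∣ ≡ h′
    sizes s′ with sides s s′
    ... | inj₁ _ = ∣ahead∣
    ... | inj₂ _ = ∣behind∣
    split : ∀ s s′ → let σ′ = next σ a h′ (s , y) C in
            Disjoint (group σ′ s′) (group σ′ (opposite s′))
    split left  left  i∈A i∈B = x∈∁p⇒x∉p (take⊆ h′ _ i∈B) (x∈p∪q⁺ (inj₂ i∈A))
    split right right i∈A i∈B = x∈∁p⇒x∉p (take⊆ h′ _ i∈B) (x∈p∪q⁺ (inj₂ i∈A))
    split left  right i∈B i∈A = x∈∁p⇒x∉p (take⊆ h′ _ i∈B) (x∈p∪q⁺ (inj₂ i∈A))
    split right left  i∈B i∈A = x∈∁p⇒x∉p (take⊆ h′ _ i∈B) (x∈p∪q⁺ (inj₂ i∈A))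
    apart : ∀ s′ → Disjoint (group (next σ a h′ (s , y) C) s′) liars′
    apart s′ with sides s s′
    ... | inj₂ _ = λ i∈B i∈L → ∉behind (x∈p∪q⁺ (inj₁ i∈L)) i∈B
    ... | inj₁ _ = λ i∈A i∈L → ahead-apart (take⊆ h′ _ i∈A) (x∈p∪q⁻ (liars σ) (take a C) i∈L)
      where
      opposite-involutive : ∀ s → opposite (opposite s) ≡ s
      opposite-involutive left  = refl
      opposite-involutive right = refl
      ahead-apart : ∀ {i} → i ∈ group σ (opposite s) → ¬ (i ∈ liars σ ⊎ i ∈ take a C)
      ahead-apart i∈ (inj₁ i∈L) = liars-disjoint G (opposite s) i∈ i∈L
      ahead-apart {i} i∈ (inj₂ i∈A) = group-disjoint G (opposite s) i∈
        (subst (λ s → i ∈ group σ s) (sym (opposite-involutive s)) (C⊆ (take⊆ a C i∈A)))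

  next-ahead : ∀ {n} {σ : State n} {a h′} s {y C} → group (next σ a h′ (s , y) C) s ⊆ group σ (opposite s)
  next-ahead left  = take⊆ _ _
  next-ahead right = take⊆ _ _

  -- Comparison of two scenarios with the same messages.

  module _ {n f : ℕ} (H : Transcript n) (T : ℝ) (pos : Fin n → ℝ → ℝ) where

    -- What a scenario whose messages agree with H up to time T says about the target.
    record World : Set where
      field
        target   : ℝ
        faulty   : Subset n
        faulty≤f : ∣ faulty ∣ ℕ.≤ f
        truthful : ∀ {i t ℓ} → i ∉ faulty → 0# ≤ t → t ≤ T → H i t ≡ just ℓ → ℓ ≡ target
        reports  : ∀ {i t} → i ∉ faulty → 0# ≤ t → t ≤ T → pos i t ≡ target →
                   ∃[ s ] (0# ≤ s × s ≤ t × H i s ≡ just target)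
    open World

    Visits : Fin n → ℝ → Set
    Visits i ℓ = ∃[ t ] (0# ≤ t × t ≤ T × pos i t ≡ ℓ)

    Announces : World → Set
    Announces W = ∃[ i ] ∃[ t ] (i ∉ faulty W × 0# ≤ t × t ≤ T × H i t ≡ just (target W))

    -- Otherwise all visitors in `G` would have been silent about the target and hence faulty, which
    -- together with `L` makes more than `f` faulty robots.
    visit⇒announces : ∀ W (G L : Subset n) → Disjoint G L → L ⊆ faulty W → f ℕ.< ∣ G ∣ ℕ.+ ∣ L ∣ →
                      (∀ {i} → i ∈ G → Visits i (target W)) → Announces W
    visit⇒announces W G L G#L L⊆F f< visits with em {Announces W}
    ... | yes a = a
    ... | no ¬a = contradiction f< (ℕₚ.≤⇒≯ (begin
      ∣ G ∣ ℕ.+ ∣ L ∣              ≤⟨ disjoint-cover G L ⊥ (faulty W) G#L L⊆F (inj₂ ∘ G⊆F) ⟩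
      ∣ ⊥ ∪ faulty W ∣             ≤⟨ ∣p∪q∣≤∣p∣+∣q∣ ⊥ (faulty W) ⟩
      ∣ ⊥ {n} ∣ ℕ.+ ∣ faulty W ∣   ≡⟨ cong (ℕ._+ ∣ faulty W ∣) (∣⊥∣≡0 n) ⟩
      ∣ faulty W ∣                 ≤⟨ faulty≤f W ⟩
      f                            ∎))
      where
      open ℕₚ.≤-Reasoning
      G⊆F : G ⊆ faulty W
      G⊆F {i} i∈G with i ∈? faulty W | visits i∈G
      ... | yes i∈F | _ = i∈F
      ... | no i∉F  | t , 0≤t , t≤T , at with reports W i∉F 0≤t t≤T at
      ...   | s , 0≤s , s≤t , Hs = contradiction (i , s , i∉F , 0≤s , ≤-trans s≤t t≤T , Hs) ¬a

    -- A robot reliable in both worlds would announce the target of `W` by its visit, which is a lie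
    -- in `W′`.
    visit⇒faulty : ∀ W W′ → target W ≢ target W′ → ∀ {i} → Visits i (target W) → i ∈ faulty W ⊎ i ∈ faulty W′
    visit⇒faulty W W′ u≢v {i} (t , 0≤t , t≤T , at) with i ∈? faulty W | i ∈? faulty W′
    ... | yes i∈F | _        = inj₁ i∈F
    ... | no _    | yes i∈F′ = inj₂ i∈F′
    ... | no i∉F  | no i∉F′ with reports W i∉F 0≤t t≤T at
    ...   | s , 0≤s , s≤t , Hs = contradiction (truthful W′ i∉F′ 0≤s (≤-trans s≤t t≤T) Hs) u≢v

    -- Every robot of G is faulty in one of the two worlds, and every robot of L in both.
    visits-decide : ∀ W W′ (G L : Subset n) → Disjoint G L → L ⊆ faulty W → L ⊆ faulty W′ →
                    2 ℕ.* f ℕ.< ∣ G ∣ ℕ.+ 2 ℕ.* ∣ L ∣ → ∀ {ℓ} → ℓ ≡ target W ⊎ ℓ ≡ target W′ →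
                    (∀ {i} → i ∈ G → Visits i ℓ) → target W ≡ target W′
    visits-decide W W′ G L G#L L⊆F L⊆F′ 2f< {ℓ} ℓ≡ visits with em {target W ≡ target W′}
    ... | yes u≡v = u≡v
    ... | no u≢v  = contradiction 2f< (ℕₚ.≤⇒≯ (begin
      ∣ G ∣ ℕ.+ 2 ℕ.* ∣ L ∣              ≤⟨ disjoint-double-cover G L _ _ G#L L⊆F L⊆F′ (split ℓ≡ ∘ visits) ⟩
      ∣ faulty W ∣ ℕ.+ ∣ faulty W′ ∣     ≤⟨ ℕₚ.+-mono-≤ (faulty≤f W) (faulty≤f W′) ⟩
      f ℕ.+ f                            ≡⟨ cong (f ℕ.+_) (sym (ℕₚ.+-identityʳ f)) ⟩
      2 ℕ.* f                            ∎))
      where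
      open ℕₚ.≤-Reasoning
      split : ℓ ≡ target W ⊎ ℓ ≡ target W′ → ∀ {i} → Visits i ℓ → i ∈ faulty W ⊎ i ∈ faulty W′
      split (inj₁ refl) v = visit⇒faulty W W′ u≢v v
      split (inj₂ refl) v with visit⇒faulty W′ W (≢-sym u≢v) v
      ... | inj₁ i∈F′ = inj₂ i∈F′
      ... | inj₂ i∈F  = inj₁ i∈F

    claimant-faulty : ∀ W {σ s y i} → 0# ≤ start σ → 0# ≤ y → start σ + y ≤ T → signed s y ≢ target W →
                      i ∈ claimants H σ s y → i ∈ faulty W
    claimant-faulty W {i = i} 0≤S 0≤y S+y≤T c≢ i∈C with i ∈? faulty W | ∈⟪⟫⁻ i∈C
    ... | yes i∈F | _ = i∈F
    ... | no i∉F  | _ , (t , 0≤t , t≤ , Ht) , _ =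
      contradiction (truthful W i∉F 0≤t (≤-trans t≤ S+y≤T) Ht) c≢

    -- The whole group stands at the target; its members that do not count as claimants are faulty,
    -- and so are the `d` liars. Hence at least `h + d - f` members claim the target.
    target-serious : ∀ W {σ h d a} → Grouped h d σ → liars σ ⊆ faulty W → a ℕ.+ f ℕ.≤ h ℕ.+ d →
                     ∀ s {y} → target W ≡ signed s y → 0# ≤ start σ → 0# ≤ y → visited σ ≤ y → start σ + y ≤ T →
                     (∀ {i} → i ∈ group σ s → pos i (start σ + y) ≡ signed s y) → Serious H σ a s y
    target-serious W {σ} {h} {d} {a} G L⊆F a+f≤ s {y} u≡ 0≤S 0≤y v≤y S+y≤T at =
      0≤y , v≤y , ℕₚ.+-cancelʳ-≤ f a _ (begin
        a ℕ.+ f                          ≤⟨ a+f≤ ⟩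
        h ℕ.+ d                          ≡⟨ sym (cong₂ ℕ._+_ (∣group∣ G s) (∣liars∣ G)) ⟩
        ∣ group σ s ∣ ℕ.+ ∣ liars σ ∣    ≤⟨ disjoint-cover _ _ C (faulty W) (liars-disjoint G s) L⊆F split ⟩
        ∣ C ∪ faulty W ∣                 ≤⟨ ∣p∪q∣≤∣p∣+∣q∣ C (faulty W) ⟩
        ∣ C ∣ ℕ.+ ∣ faulty W ∣           ≤⟨ ℕₚ.+-monoʳ-≤ ∣ C ∣ (faulty≤f W) ⟩
        ∣ C ∣ ℕ.+ f                      ∎)
      where
      open ℕₚ.≤-Reasoning
      C = claimants H σ s y
      split : ∀ {i} → i ∈ group σ s → i ∈ C ⊎ i ∈ faulty W
      split {i} i∈ with i ∈? faulty W
      ... | yes i∈F = inj₂ i∈F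
      ... | no i∉F with reports W i∉F (+-nonNeg 0≤S 0≤y) S+y≤T (trans (at i∈) (sym u≡))
      ...   | t , 0≤t , t≤ , Ht = inj₁ (∈⟪⟫⁺ (i∈ , (t , 0≤t , t≤ , trans Ht (cong just u≡)) ,
                λ {_} {_} 0≤t t≤ Ht → trans (truthful W i∉F 0≤t (≤-trans t≤ S+y≤T) Ht) u≡))

    Follows : ∀ {r h d} → Plan n f r h d → State n → Set
    Follows P σ = ∀ i {t} → start σ ≤ t → pos i t ≡ path P σ H i t

    -- If no serious claim came before the target, the sweep would reach it undisturbed and the
    -- target itself would become a serious claim.
    First-≤-target : ∀ W {r h d} (P : Plan n f r h d) {σ} → Grouped h d σ → Follows P σ → liars σ ⊆ faulty W →
                     ∀ s {y} → target W ≡ signed s y → 0# ≤ start σ → 0# ≤ y → visited σ ≤ y → start σ + y ≤ T →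
                     ∃[ e ] (First H σ (threshold P) e × proj₂ e ≤ y)
    First-≤-target W P {σ} G follows L⊆F s {y} u≡ 0≤S 0≤y v≤y S+y≤T = compare em
      where
      serious : (∀ {e} → First H σ (threshold P) e → start σ + y ≤ start σ + proj₂ e) → Serious H σ (threshold P) s y
      serious undisturbed = target-serious W G L⊆F (threshold-≤ P) s u≡ 0≤S 0≤y v≤y S+y≤T λ {i} i∈ →
        trans (follows i (x≤x+y 0≤y)) (trans (path-outward P i undisturbed) (outward-group G s y i∈))
      compare : Dec (∃ (First H σ (threshold P))) → ∃[ e ] (First H σ (threshold P) e × proj₂ e ≤ y)
      compare (no none) =
        contradiction (∃-First {n} {H} {σ} {threshold P} {s} (0<threshold P) (serious λ first → contradiction (-, first) none)) none
      compare (yes (e₀ , first@(_ , least , _))) with ≤-total (proj₂ e₀) y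
      ... | inj₁ y₀≤y = e₀ , first , y₀≤y
      ... | inj₂ y≤y₀ = e₀ , first , least (serious undisturbed)
        where
        undisturbed : ∀ {e} → First H σ (threshold P) e → start σ + y ≤ start σ + proj₂ e
        undisturbed first′ with refl ← First-unique {n} {H} {σ} {threshold P} first first′ = +-monoʳ-≤ _ y≤y₀

    claimants⊆ : ∀ σ s y → claimants H σ s y ⊆ group σ s
    claimants⊆ σ s y i∈ = proj₁ (∈⟪⟫⁻ i∈)

    -- Serves the world whose target may be too far to be reached by time `T`: only the first claim
    -- has to be made in time. It preserves the bound by `visited` across a restart.
    First-≤-rival : ∀ (W : World) {r h d} (P : Plan n f r h d) {σ} → Grouped h d σ → Follows P σ →
                    liars σ ⊆ faulty W → ∀ s {y} → target W ≡ signed s y → 0# ≤ start σ → 0# ≤ y → visited σ ≤ y →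
                    ∀ {c x} → First H σ (threshold P) (c , x) → start σ + x ≤ T → x ≤ y
    First-≤-rival W P {σ} G follows L⊆F s {y} u≡ 0≤S 0≤y v≤y {c} {x} first S+x≤T with ≤-total x y
    ... | inj₁ x≤y = x≤y
    ... | inj₂ y≤x with First-≤-target W P G follows L⊆F s u≡ 0≤S 0≤y v≤y (≤-trans (+-monoʳ-≤ _ y≤x) S+x≤T)
    ...   | e , first′ , x′≤y with refl ← First-unique {n} {H} {σ} {threshold P} first first′ = x′≤y

    first-leg : ∀ {r h d} (P : Plan n f r h d) {σ} → Grouped h d σ → Follows P σ → ∀ s {y} → 0# ≤ y →
                (∀ {c x} → First H σ (threshold P) (c , x) → y ≤ x) →
                ∀ {i} → i ∈ group σ s → pos i (start σ + y) ≡ signed s y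
    first-leg P G follows s {y} 0≤y y≤ {i} i∈ = trans (follows i (x≤x+y 0≤y))
      (trans (path-outward P i λ first → +-monoʳ-≤ _ (y≤ first)) (outward-group G s y i∈))

    final-group : ∀ {h d} b p q r t → let P = final {n} {f} {h} {d} b p q r t in ∀ {σ} → Grouped h d σ →
                  Follows P σ → ∀ {c x} → First H σ b (c , x) → ∀ s {y} → 0# ≤ y →
                  ∀ {i} → i ∈ group σ s → pos i (start σ + y) ≡ signed s y
    final-group b p q r t {σ} G follows {c} {x} first s {y} 0≤y {i} i∈ with ≤-total y x
    ... | inj₁ y≤x = first-leg (final b p q r t) G follows s 0≤y
      (λ first′ → subst (λ e → y ≤ proj₂ e) (First-unique {n} {H} {σ} {b} first first′) y≤x) i∈
    ... | inj₂ x≤y = trans (follows i (x≤x+y 0≤y))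
      (trans (path-after (final b p q r t) i first (+-monoʳ-≤ _ x≤y))
      (trans (cong (λ v → pursue σ (c , x) v (start σ + y)) (heading-group G s i∈))
             (cong (signed s) (x+y-x≡y (start σ) y))))

    -- The group on the side of the claim is at distance `y` at time `start σ + y`; the robots that
    -- waited arrive `x` later.
    final-pursuit : ∀ {h d} b p q r t → let P = final {n} {f} {h} {d} b p q r t in ∀ {σ} → Grouped h d σ →
                    Follows P σ → ∀ {c x} → First H σ b (c , x) → 0# ≤ start σ → ∀ {y} → x ≤ y → start σ + x + y ≤ T →
                    ∀ {i} → i ∉ group σ (opposite c) → Visits i (signed c y)
    final-pursuit b p q r t {σ} G follows {c} {x} first@((0≤x , _) , _) 0≤S {y} x≤y S+x+y≤T {i} i∉ with i ∈? group σ c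
    ... | yes i∈ = start σ + y , +-nonNeg 0≤S 0≤y , ≤-trans (+-monoˡ-≤ y (x≤x+y 0≤x)) S+x+y≤T ,
                   final-group b p q r t G follows first c 0≤y i∈
      where 0≤y = ≤-trans 0≤x x≤y
    ... | no i∉c = start σ + x + y , +-nonNeg (+-nonNeg 0≤S 0≤x) 0≤y , S+x+y≤T ,
        trans (follows i (≤-trans (x≤x+y 0≤x) (x≤x+y 0≤y)))
       (trans (path-after (final b p q r t) i first (x≤x+y 0≤y))
       (trans (cong (λ v → pursue σ (c , x) v (start σ + x + y)) (heading-none σ unassigned))
              (cong (signed c) (x+y-x≡y (start σ + x) y))))
      where
      0≤y = ≤-trans 0≤x x≤y
      unassigned : ∀ s → i ∉ group σ s
      unassigned s with sides c s
      ... | inj₁ refl = i∉c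
      ... | inj₂ refl = i∉

    Located : World → World → Set
    Located W W′ = target W ≡ target W′ × Announces W

    -- Induction over the plan. `W` is the true world, and only its target obeys the time bound;
    -- `W′` is any rival. The liars are faulty in both as long as no earlier claim is the target of
    -- either.
    locate : ∀ {r h d} (P : Plan n f r h d) {σ} → Grouped h d σ → Follows P σ → 0# ≤ start σ →
             ∀ (W W′ : World) → liars σ ⊆ faulty W → liars σ ⊆ faulty W′ →
             ∀ s {y} → target W ≡ signed s y → 0# ≤ y → visited σ ≤ y →
             ∀ s′ {y′} → target W′ ≡ signed s′ y′ → 0# ≤ y′ → visited σ ≤ y′ →
             start σ + need r y ≤ T → Located W W′

    locate {r} {h} {d} P@(final b 0<b b+f≤ 2f+h< 2f<) {σ} G follows 0≤S W W′ L⊆F L⊆F′ s {y} u≡ 0≤y v≤y s′ {y′} v≡ 0≤y′ v≤y′ S+2y≤T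
      with First-≤-target W P G follows L⊆F s u≡ 0≤S 0≤y v≤y (≤-trans (+-monoʳ-≤ _ (x≤x+y 0≤y)) S+2y≤T)
    ... | (c , x) , first@((0≤x , _ , b≤) , _) , x≤y = decide , announced
      where
      S+y≤T : start σ + y ≤ T
      S+y≤T = ≤-trans (+-monoʳ-≤ _ (x≤x+y 0≤y)) S+2y≤T
      S+x≤T : start σ + x ≤ T
      S+x≤T = ≤-trans (+-monoʳ-≤ _ x≤y) S+y≤T
      group-visits : ∀ s → target W ≡ signed s y → ∀ {i} → i ∈ group σ s → Visits i (target W)
      group-visits s u≡ i∈ = start σ + y , +-nonNeg 0≤S 0≤y , S+y≤T ,
                      trans (final-group b 0<b b+f≤ 2f+h< 2f< G follows first s 0≤y i∈) (sym u≡)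
      announced : Announces W
      announced = visit⇒announces W _ _ (liars-disjoint G s) L⊆F
        (subst (f ℕ.<_) (sym (cong₂ ℕ._+_ (∣group∣ G s) (∣liars∣ G))) (ℕₚ.≤-trans (ℕₚ.+-monoˡ-≤ f 0<b) b+f≤))
        (group-visits s u≡)
      others = ∁ (group σ (opposite c) ∪ liars σ)
      -- At least `n - h - d` robots are in `others`, and each of the `d` liars counts twice.
      2f<others : 2 ℕ.* f ℕ.< ∣ others ∣ ℕ.+ 2 ℕ.* ∣ liars σ ∣
      2f<others = ℕₚ.+-cancelʳ-< h _ _ (begin-strict
        2 ℕ.* f ℕ.+ h                                <⟨ 2f+h< ⟩
        n ℕ.+ d                                      ≤⟨ ℕₚ.+-monoˡ-≤ d (ℕₚ.m≤n+m∸n n k) ⟩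
        k ℕ.+ (n ℕ.∸ k) ℕ.+ d                        ≡⟨ cong (λ m → k ℕ.+ m ℕ.+ d) (sym (∣∁p∣≡n∸∣p∣ (group σ (opposite c) ∪ liars σ))) ⟩
        k ℕ.+ ∣ others ∣ ℕ.+ d                       ≤⟨ ℕₚ.+-monoˡ-≤ d (ℕₚ.+-monoˡ-≤ ∣ others ∣ (∣p∪q∣≤∣p∣+∣q∣ (group σ (opposite c)) (liars σ))) ⟩
        ∣ group σ (opposite c) ∣ ℕ.+ ∣ liars σ ∣ ℕ.+ ∣ others ∣ ℕ.+ d
                                                     ≡⟨ cong₂ (λ a b → a ℕ.+ b ℕ.+ ∣ others ∣ ℕ.+ d) (∣group∣ G (opposite c)) (∣liars∣ G) ⟩
        h ℕ.+ d ℕ.+ ∣ others ∣ ℕ.+ d                 ≡⟨ rearrange h d ∣ others ∣ ⟩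
        ∣ others ∣ ℕ.+ 2 ℕ.* d ℕ.+ h                 ≡⟨ cong (λ l → ∣ others ∣ ℕ.+ 2 ℕ.* l ℕ.+ h) (sym (∣liars∣ G)) ⟩
        ∣ others ∣ ℕ.+ 2 ℕ.* ∣ liars σ ∣ ℕ.+ h       ∎)
        where
        open ℕₚ.≤-Reasoning
        k = ∣ group σ (opposite c) ∪ liars σ ∣
        rearrange : ∀ h d o → h ℕ.+ d ℕ.+ o ℕ.+ d ≡ o ℕ.+ 2 ℕ.* d ℕ.+ h
        rearrange = ℕ-solve-∀
      by-others : ∀ {z} → x ≤ z → start σ + x + z ≤ T → signed c z ≡ target W ⊎ signed c z ≡ target W′ → target W ≡ target W′
      by-others x≤z in-time z≡ = visits-decide W W′ others (liars σ)
        (λ i∈ i∈L → x∈∁p⇒x∉p i∈ (x∈p∪q⁺ (inj₂ i∈L))) L⊆F L⊆F′ 2f<others z≡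
        λ i∈ → final-pursuit b 0<b b+f≤ 2f+h< 2f< G follows first 0≤S x≤z in-time λ i∈G → x∈∁p⇒x∉p i∈ (x∈p∪q⁺ (inj₁ i∈G))
      S+x+y≤T : start σ + x + y ≤ T
      S+x+y≤T = ≤-trans (≤-reflexive (+-assoc _ _ _)) (≤-trans (+-monoʳ-≤ _ (+-monoˡ-≤ y x≤y)) S+2y≤T)
      S+x+x≤T : start σ + x + x ≤ T
      S+x+x≤T = ≤-trans (+-monoʳ-≤ _ x≤y) S+x+y≤T
      decide : target W ≡ target W′
      -- If the claim is one of the two targets, `others` decide at the claim. If it is neither, its
      -- claimants are faulty in both worlds, and the vote takes place at the target of `W`: by
      -- `others` if it lies on the side of the claim, and by the opposite group otherwise.
      decide with em {signed c x ≡ target W} | em {signed c x ≡ target W′}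
      ... | yes c≡u | _       = by-others ≤-refl S+x+x≤T (inj₁ c≡u)
      ... | no _    | yes c≡v = by-others ≤-refl S+x+x≤T (inj₂ c≡v)
      ... | no c≢u  | no c≢v with sides c s
      ...   | inj₁ refl = by-others x≤y S+x+y≤T (inj₁ (sym u≡))
      ...   | inj₂ refl = visits-decide W W′ (group σ (opposite c)) (liars σ ∪ C)
        apart (liars-faulty W c≢u L⊆F) (liars-faulty W′ c≢v L⊆F′) enough (inj₁ refl) (group-visits (opposite c) u≡)
        where
        C = claimants H σ c x
        liars-faulty : ∀ W → signed c x ≢ target W → liars σ ⊆ faulty W → liars σ ∪ C ⊆ faulty W
        liars-faulty W c≢ L⊆F i∈ with x∈p∪q⁻ (liars σ) C i∈
        ... | inj₁ i∈L = L⊆F i∈L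
        ... | inj₂ i∈C = claimant-faulty W {σ} {c} 0≤S 0≤x S+x≤T c≢ i∈C
        apart : Disjoint (group σ (opposite c)) (liars σ ∪ C)
        apart i∈ i∈LC with x∈p∪q⁻ (liars σ) C i∈LC
        ... | inj₁ i∈L = liars-disjoint G (opposite c) i∈ i∈L
        ... | inj₂ i∈C = group-disjoint G c (claimants⊆ σ c x i∈C) i∈
        ∣L∪C∣ : d ℕ.+ b ℕ.≤ ∣ liars σ ∪ C ∣
        ∣L∪C∣ = subst (d ℕ.+ b ℕ.≤_)
          (sym (disjoint⇒∣p∪q∣≡∣p∣+∣q∣ (liars σ) C λ i∈L i∈C → liars-disjoint G c (claimants⊆ σ c x i∈C) i∈L))
          (ℕₚ.+-mono-≤ (ℕₚ.≤-reflexive (sym (∣liars∣ G))) b≤)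
        enough : 2 ℕ.* f ℕ.< ∣ group σ (opposite c) ∣ ℕ.+ 2 ℕ.* ∣ liars σ ∪ C ∣
        enough = ℕₚ.<-≤-trans 2f< (ℕₚ.+-mono-≤ (ℕₚ.≤-reflexive (sym (∣group∣ G (opposite c)))) (ℕₚ.*-monoʳ-≤ 2 ∣L∪C∣))

    locate {suc r} {h} {d} P@(step a h′ 0<a a+f≤ h′≤h room 2f< P′) {σ} G follows 0≤S W W′ L⊆F L⊆F′ s {y} u≡ 0≤y v≤y s′ {y′} v≡ 0≤y′ v≤y′ in-time
      with First-≤-target W P G follows L⊆F s u≡ 0≤S 0≤y v≤y
             (≤-trans (+-monoʳ-≤ _ (≤-trans (x≤x+y 0≤y) (x≤x+y (≤-trans (+-nonNeg 0≤y 0≤y) (need-≥ r 0≤y))))) in-time)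
    ... | (c , x) , first@((0≤x , _ , a≤) , _) , x≤y = result
      where
      S = start σ
      σ′ = next σ a h′ (c , x) (claimants H σ c x)
      G′ : Grouped h′ (d ℕ.+ a) σ′
      G′ = next-grouped G c x h′≤h room (claimants⊆ σ c x) a≤
      2x≤2y : x + x ≤ y + y
      2x≤2y = +-mono-≤ x≤y x≤y
      in-time′ : S + x + x + need r y ≤ T
      in-time′ = ≤-trans (≤-reflexive (regroup S x (need r y))) (≤-trans (+-monoʳ-≤ S (+-monoˡ-≤ (need r y) 2x≤2y)) in-time)
        where regroup : ∀ S x m → S + x + x + m ≡ S + (x + x + m)
              regroup = solve 3 (λ S x m → S :+ x :+ x :+ m := S :+ (x :+ x :+ m)) refl
      revisit-in-time : S + x + x + x ≤ T
      revisit-in-time = ≤-trans (+-monoʳ-≤ _ (≤-trans x≤y (≤-trans (x≤x+y 0≤y) (need-≥ r 0≤y)))) in-time′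
      0≤S′ : 0# ≤ S + x + x
      0≤S′ = +-nonNeg (+-nonNeg 0≤S 0≤x) 0≤x
      S+x≤T : S + x ≤ T
      S+x≤T = ≤-trans (≤-trans (x≤x+y 0≤x) (x≤x+y 0≤x)) revisit-in-time
      follows′ : Follows P′ σ′
      follows′ i {t} S′≤t = trans (follows i (≤-trans (≤-trans (x≤x+y 0≤x) (x≤x+y 0≤x)) S′≤t))
        (trans (path-after P i first (≤-trans (x≤x+y 0≤x) S′≤t))
               (glue-≥ _ _ (restart-continuous P′ c x) S′≤t))
      ahead⊆ : group σ′ c ⊆ group σ (opposite c)
      ahead⊆ = next-ahead {σ = σ} {a} {h′} c {x} {claimants H σ c x}
      voters = group σ c ∪ group σ′ c
      first-visit : ∀ {i} → i ∈ group σ c → Visits i (signed c x)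
      first-visit i∈ = S + x , +-nonNeg 0≤S 0≤x , S+x≤T , first-leg P G follows c 0≤x
        (λ first′ → ≤-reflexive (cong proj₂ (First-unique {n} {H} {σ} {a} first first′))) i∈
      -- The new state has `visited` equal to `x`, so no serious claim interrupts the way of the
      -- robots sent ahead to distance `x`.
      second-visit : ∀ {i} → i ∈ group σ′ c → Visits i (signed c x)
      second-visit i∈ = S + x + x + x , +-nonNeg 0≤S′ 0≤x , revisit-in-time ,
        first-leg P′ G′ follows′ c 0≤x (λ ((_ , x≤x′ , _) , _) → x≤x′) i∈
      apart : Disjoint voters (liars σ)
      apart i∈ i∈L with x∈p∪q⁻ (group σ c) (group σ′ c) i∈
      ... | inj₁ i∈G  = liars-disjoint G c i∈G i∈L
      ... | inj₂ i∈G′ = liars-disjoint G (opposite c) (ahead⊆ i∈G′) i∈L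
      settle : signed c x ≡ target W ⊎ signed c x ≡ target W′ → target W ≡ target W′
      settle c≡ = visits-decide W W′ voters (liars σ) apart L⊆F L⊆F′
        (subst (2 ℕ.* f ℕ.<_) (sym (cong₂ (λ g l → g ℕ.+ 2 ℕ.* l)
          (trans (disjoint⇒∣p∪q∣≡∣p∣+∣q∣ _ _ λ i∈G i∈G′ → group-disjoint G c i∈G (ahead⊆ i∈G′))
                 (cong₂ ℕ._+_ (∣group∣ G c) (∣group∣ G′ c)))
          (∣liars∣ G))) 2f<)
        c≡ λ i∈ → visits (x∈p∪q⁻ (group σ c) (group σ′ c) i∈)
        where
        visits : ∀ {i} → i ∈ group σ c ⊎ i ∈ group σ′ c → Visits i (signed c x)
        visits (inj₁ i∈) = first-visit i∈
        visits (inj₂ i∈) = second-visit i∈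
      liars-faulty : ∀ W → signed c x ≢ target W → liars σ ⊆ faulty W → liars σ′ ⊆ faulty W
      liars-faulty W c≢ L⊆F i∈ with x∈p∪q⁻ (liars σ) (take a (claimants H σ c x)) i∈
      ... | inj₁ i∈L = L⊆F i∈L
      ... | inj₂ i∈A = claimant-faulty W {σ} {c} 0≤S 0≤x S+x≤T c≢ (take⊆ a _ i∈A)
      result : Located W W′
      -- A claim of either target is settled by `voters`, which also rules out that only the rival
      -- has its target there. If neither target is there, the chosen claimants are faulty in both
      -- worlds and the induction goes on.
      result with em {signed c x ≡ target W} | em {signed c x ≡ target W′}
      ... | yes c≡u | _ = settle (inj₁ c≡u) ,
        visit⇒announces W _ _ (liars-disjoint G c) L⊆F
          (subst (f ℕ.<_) (sym (cong₂ ℕ._+_ (∣group∣ G c) (∣liars∣ G))) (ℕₚ.≤-trans (ℕₚ.+-monoˡ-≤ f 0<a) a+f≤))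
          (λ {i} i∈ → subst (Visits i) c≡u (first-visit i∈))
      ... | no c≢u | yes c≡v = contradiction (trans c≡v (sym (settle (inj₂ c≡v)))) c≢u
      ... | no c≢u | no c≢v = locate P′ G′ follows′ 0≤S′ W W′ (liars-faulty W c≢u L⊆F) (liars-faulty W′ c≢v L⊆F′)
        s u≡ 0≤y x≤y s′ v≡ 0≤y′ (First-≤-rival W′ P G follows L⊆F′ s′ v≡ 0≤S 0≤y′ v≤y′ first S+x≤T) in-time′

  -- The search algorithm and its completion time.

  initial : ∀ n → ℕ → State n
  initial n h = record { start = 0# ; visited = 0# ; group = groups ; liars = ⊥ }
    where
    groups : Side → Subset n
    groups right = take h ⊤
    groups left  = take h (∁ (take h ⊤))

  initial-grouped : ∀ {n h} → h ℕ.+ h ℕ.≤ n → Grouped h 0 (initial n h)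
  initial-grouped {n} {h} 2h≤n = record
    { ∣group∣        = sizes
    ; ∣liars∣        = ∣⊥∣≡0 n
    ; group-disjoint = apart
    ; liars-disjoint = λ _ _ → ∉⊥
    }
    where
    ∣right∣ : ∣ take h (⊤ {n}) ∣ ≡ h
    ∣right∣ = ∣take∣ h (⊤ {n}) (subst (h ℕ.≤_) (sym (∣⊤∣≡n n)) (ℕₚ.m+n≤o⇒m≤o h 2h≤n))
    sizes : ∀ s → ∣ group (initial n h) s ∣ ≡ h
    sizes right = ∣right∣
    sizes left  = ∣take∣ h (∁ (take h (⊤ {n})))
      (subst (h ℕ.≤_) (sym (trans (∣∁p∣≡n∸∣p∣ (take h (⊤ {n}))) (cong (n ℕ.∸_) ∣right∣))) (ℕₚ.m+n≤o⇒m≤o∸n h 2h≤n))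
    apart : ∀ s → Disjoint (group (initial n h) s) (group (initial n h) (opposite s))
    apart right i∈R i∈L = x∈∁p⇒x∉p (take⊆ h _ i∈L) i∈R
    apart left  i∈L i∈R = x∈∁p⇒x∉p (take⊆ h _ i∈L) i∈R

  algorithm : ∀ {n f r h} → Plan n f r h 0 → Algorithm n
  algorithm {n} {h = h} P = record
    { position     = path P (initial n h)
    ; isTrajectory = λ H i → record
      { start = path-start P i
      ; speed = λ s t _ s≤t → path-lipschitz P i s≤t
      }
    ; causal       = λ H H′ t _ agree i → path-causal P i agree
    }

  need-linear : ∀ r d → need r d ≡ fromℕ (2 ℕ.* suc r) * d
  need-linear zero    d = sym (trans (distribʳ d 1# _)
    (cong₂ _+_ (*-identityˡ d) (trans (cong (_* d) (+-identityʳ 1#)) (*-identityˡ d))))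
  need-linear (suc r) d = trans (cong (d + d +_) (need-linear r d)) (trans (expand d (fromℕ (2 ℕ.* suc r)))
      (cong (λ k → fromℕ k * d) (sym (ℕₚ.*-suc 2 (suc r)))))
    where
    expand : ∀ d m → d + d + m * d ≡ (1# + (1# + m)) * d
    expand d m = sym (trans (distribʳ d 1# _)
      (trans (cong₂ _+_ (*-identityˡ d) (trans (distribʳ d 1# m) (cong (_+ m * d) (*-identityˡ d))))
             (sym (+-assoc d d (m * d)))))

  -- Certainty follows by comparing the actual scenario with every scenario that has the same
  -- messages up to `need r d`; the announcement follows by comparing it with itself.
  search : ∀ {n f r h} → Plan n f r h 0 → h ℕ.+ h ℕ.≤ n → SearchTime≤ n f (fromℕ (2 ℕ.* suc r))
  search {n} {f} {r} {h} P 2h≤n = algorithm P , λ d (0≤d , 0≢d) σ target≡ →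
    need r d , ≤-reflexive (need-linear r d) , completed d 0≤d σ target≡
    where
    open Algorithm (algorithm P)
    completed : ∀ d → 0# ≤ d → (σ : Scenario (algorithm P) f) → Scenario.target σ ≡ d ⊎ Scenario.target σ ≡ - d →
                CompletedBy σ (need r d)
    completed d 0≤d σ target≡ = announced , λ τ agree → sym (proj₁ (located τ agree))
      where
      module σ = Scenario σ
      T-end = need r d
      world : (τ : Scenario (algorithm P) f) → AgreeUpTo T-end σ.transcript (Scenario.transcript τ) →
              World {f = f} σ.transcript T-end (position σ.transcript)
      world τ agree = record
        { target   = τ.target
        ; faulty   = τ.faulty
        ; faulty≤f = τ.faulty≤f
        ; truthful = λ {i} {t} i∉F 0≤t t≤T Ht → τ.truthful i i∉F t _ 0≤t (trans (sym (agree i t 0≤t t≤T)) Ht)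
        -- By causality, up to `T-end` the reliable robots of `τ` are where the messages of `σ` send
        -- them.
        ; reports  = λ {i} {t} i∉F 0≤t t≤T at → transfer (τ.reports i i∉F t 0≤t
            (trans (τ.follows i i∉F t 0≤t)
            (trans (sym (causal σ.transcript τ.transcript t 0≤t
                     (λ j s 0≤s (s≤t , _) → agree j s 0≤s (≤-trans s≤t t≤T)) i)) at))) t≤T
        }
        where
        module τ = Scenario τ
        transfer : ∀ {i t} → ∃[ s ] (0# ≤ s × s ≤ t × τ.transcript i s ≡ just τ.target) → t ≤ T-end →
                   ∃[ s ] (0# ≤ s × s ≤ t × σ.transcript i s ≡ just τ.target)
        transfer {i} (s , 0≤s , s≤t , Hs) t≤T = s , 0≤s , s≤t , trans (agree i s 0≤s (≤-trans s≤t t≤T)) Hs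
      side : σ.target ≡ d ⊎ σ.target ≡ - d → ∃[ s ] σ.target ≡ signed s d
      side (inj₁ eq) = right , eq
      side (inj₂ eq) = left , eq
      polar : ∀ x → ∃[ s ] ∃[ y ] (x ≡ signed s y × 0# ≤ y)
      polar x with ≤-total 0# x
      ... | inj₁ 0≤x = right , x , refl , 0≤x
      ... | inj₂ x≤0 = left , - x , sym (-‿involutive x) , subst (_≤ - x) -0#≈0# (neg-antimono-≤ x≤0)
      located : ∀ τ agree → Located σ.transcript T-end (position σ.transcript) (world σ (λ _ _ _ _ → refl)) (world τ agree)
      located τ agree with side target≡ | polar (Scenario.target τ)
      ... | s , u≡ | s′ , y′ , v≡ , 0≤y′ =
        locate σ.transcript T-end (position σ.transcript) P (initial-grouped 2h≤n) (λ _ _ → refl) ≤-refl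
               (world σ (λ _ _ _ _ → refl)) (world τ agree) (λ i∈ → contradiction i∈ ∉⊥) (λ i∈ → contradiction i∈ ∉⊥)
               s u≡ 0≤d 0≤d s′ v≡ 0≤y′ 0≤y′ (≤-reflexive (+-identityˡ _))
      announced : Announced σ T-end
      announced with proj₂ (located σ (λ _ _ _ _ → refl))
      ... | i , t , i∉F , 0≤t , t≤T , Ht = i , t , i∉F , 0≤t , t≤T , Ht

  -- From a density of faulty robots to numbers of robots.

  archimedean : ∀ x → ∃[ n ] x ≤ fromℕ n
  archimedean x with em {∃[ n ] x ≤ fromℕ n}
  ... | yes found = found
  ... | no none with supremum (λ y → ∃[ n ] y ≡ fromℕ n) (0# , 0 , refl)
                       (x , λ { y (n , refl) → ≰⇒≥ λ x≤n → none (n , x≤n) })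
  -- With a supremum `s` of the naturals, `s - 1#` would bound them as well, since `suc n` is a
  -- natural too.
  ...   | s , upper , least = contradiction (+-cancelʳ-≤ (s - 1#)
            (subst₂ _≤_ (regroup s 1#) (sym (+-identityˡ _)) (least (s - 1#) λ { y (n , refl) →
              subst₂ _≤_ (x+y-x≡y 1# (fromℕ n)) refl (+-monoˡ-≤ (- 1#) (upper _ (suc n , refl))) }))) 1≰0
    where
    regroup : ∀ s o → s ≡ o + (s - o)
    regroup = solve 2 (λ s o → s := o :+ (s :- o)) refl

  ceiling : ∀ x → 0# ≤ x → ∃[ n ] IsCeiling x n
  ceiling x 0≤x with archimedean x
  ... | n , x≤n = descend n x≤n
    where
    descend : ∀ n → x ≤ fromℕ n → ∃[ n ] IsCeiling x n
    descend zero    x≤0 = 0 , ≰⇒> (λ x≤-1 → 1≰0 (subst₂ _≤_ (+-identityʳ 1#) (trans (cong (1# +_) (+-identityˡ (- 1#))) (-‿inverseʳ 1#))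
                                       (+-monoʳ-≤ 1# (≤-trans 0≤x x≤-1)))) , x≤0
    descend (suc m) x≤  with em {x ≤ fromℕ m}
    ... | yes x≤m = descend m x≤m
    ... | no x≰m  = suc m , subst (_< x) (sym (x+y-x≡y 1# (fromℕ m))) (≰⇒> x≰m) , x≤

  -- One schedule serves all `f`: its unit `z` is about `f / p`, and the number of robots `q z` that
  -- it needs is about `q f / p`, which is at most `f / β`.
  achievable : ∀ {p q r h} → 0 ℕ.< p → 0 ℕ.< q → Schedule p q r h 0 → h ℕ.+ h ℕ.≤ q →
               ∀ β → 0# < β → β ≤ fromℕ p / fromℕ q → Achievable β (fromℕ (2 ℕ.* suc r))
  -- Of the constant, `q` covers the rounding of the unit and 4 the additional robots of the plan.
  achievable {suc p-1} {q} {r} {h} 0<p 0<q schedule 2h≤q β 0<β β≤p/q = fromℕ (q ℕ.+ 4) , λ f _ → robots f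
    where
    p = suc p-1
    robots : ∀ f → ∃[ n ] (IsCeiling (fromℕ f / β + fromℕ (q ℕ.+ 4)) n × SearchTime≤ n f (fromℕ (2 ℕ.* suc r)))
    robots f with ceiling (fromℕ f / β + fromℕ (q ℕ.+ 4))
                    (+-nonNeg (*-nonNeg (0≤fromℕ f) (⁻¹-nonNeg 0<β)) (0≤fromℕ (q ℕ.+ 4)))
    ... | n , n-ceiling@(_ , x≤n) = n , n-ceiling , search (schedule⇒plan {p} (ℕ.s≤s ℕ.z≤n) f≤pz qz+4≤n schedule) 2h≤n
      where
      -- The successor makes the unit positive and gives `f ≤ p z ≤ f + p`.
      z = suc (f ℕ./ p)
      f≤pz : f ℕ.≤ p ℕ.* z
      f≤pz = begin
        f                            ≡⟨ m≡m%n+[m/n]*n f p ⟩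
        f ℕ.% p ℕ.+ f ℕ./ p ℕ.* p    ≤⟨ ℕₚ.+-monoˡ-≤ (f ℕ./ p ℕ.* p) (ℕₚ.<⇒≤ (m%n<n f p)) ⟩
        z ℕ.* p                      ≡⟨ ℕₚ.*-comm z p ⟩
        p ℕ.* z                      ∎
        where open ℕₚ.≤-Reasoning
      pz≤f+p : p ℕ.* z ℕ.≤ f ℕ.+ p
      pz≤f+p = begin
        p ℕ.* z                ≡⟨ ℕₚ.*-comm p z ⟩
        p ℕ.+ f ℕ./ p ℕ.* p    ≤⟨ ℕₚ.+-monoʳ-≤ p (m/n*n≤m f p) ⟩
        p ℕ.+ f                ≡⟨ ℕₚ.+-comm p f ⟩
        f ℕ.+ p                ∎
        where open ℕₚ.≤-Reasoning
      integral : (q ℕ.* z ℕ.+ 4) ℕ.* p ℕ.≤ q ℕ.* f ℕ.+ (q ℕ.+ 4) ℕ.* p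
      integral = begin
        (q ℕ.* z ℕ.+ 4) ℕ.* p              ≡⟨ e₁ q z p ⟩
        q ℕ.* (p ℕ.* z) ℕ.+ 4 ℕ.* p        ≤⟨ ℕₚ.+-monoˡ-≤ (4 ℕ.* p) (ℕₚ.*-monoʳ-≤ q pz≤f+p) ⟩
        q ℕ.* (f ℕ.+ p) ℕ.+ 4 ℕ.* p        ≡⟨ e₂ q f p ⟩
        q ℕ.* f ℕ.+ (q ℕ.+ 4) ℕ.* p        ∎
        where
        open ℕₚ.≤-Reasoning
        e₁ : ∀ q z p → (q ℕ.* z ℕ.+ 4) ℕ.* p ≡ q ℕ.* (p ℕ.* z) ℕ.+ 4 ℕ.* p
        e₁ = ℕ-solve-∀
        e₂ : ∀ q f p → q ℕ.* (f ℕ.+ p) ℕ.+ 4 ℕ.* p ≡ q ℕ.* f ℕ.+ (q ℕ.+ 4) ℕ.* p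
        e₂ = ℕ-solve-∀
      F = fromℕ f
      βq≤p : β * fromℕ q ≤ fromℕ p
      βq≤p = subst (β * fromℕ q ≤_) (/-cancel (fromℕ p) (fromℕ q) (fromℕ-pos 0<q))
                   (*-monoʳ-≤-nonNeg (fromℕ q) (0≤fromℕ q) β≤p/q)
      qf≤ : fromℕ q * F ≤ F / β * fromℕ p
      qf≤ = subst₂ _≤_ (trans (reorder β (fromℕ q) (F / β)) (cong (fromℕ q *_) (/-cancel F β 0<β))) (*-comm _ _)
              (*-monoʳ-≤-nonNeg (F / β) (*-nonNeg (0≤fromℕ f) (⁻¹-nonNeg 0<β)) βq≤p)
        where reorder : ∀ b q x → b * q * x ≡ q * (x * b)
              reorder = solve 3 (λ b q x → b :* q :* x := q :* (x :* b)) refl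
      qz+4≤n : q ℕ.* z ℕ.+ 4 ℕ.≤ n
      qz+4≤n = fromℕ-cancel-≤ (≤-trans (*-cancelʳ-≤ (fromℕ p) (fromℕ-pos 0<p) scaled) x≤n)
        where
        scaled : fromℕ (q ℕ.* z ℕ.+ 4) * fromℕ p ≤ (F / β + fromℕ (q ℕ.+ 4)) * fromℕ p
        scaled = ≤-trans (subst₂ _≤_ (fromℕ-* (q ℕ.* z ℕ.+ 4) p)
                   (trans (fromℕ-+ (q ℕ.* f) ((q ℕ.+ 4) ℕ.* p)) (cong₂ _+_ (fromℕ-* q f) (fromℕ-* (q ℕ.+ 4) p))) (fromℕ-mono-≤ integral))
                   (≤-trans (+-monoˡ-≤ _ qf≤) (≤-reflexive (sym (distribʳ _ _ _))))
      2h≤n : h ℕ.* z ℕ.+ 2 ℕ.+ (h ℕ.* z ℕ.+ 2) ℕ.≤ n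
      2h≤n = begin
        h ℕ.* z ℕ.+ 2 ℕ.+ (h ℕ.* z ℕ.+ 2)  ≡⟨ e h z ⟩
        (h ℕ.+ h) ℕ.* z ℕ.+ 4              ≤⟨ ℕₚ.+-monoˡ-≤ 4 (ℕₚ.*-monoˡ-≤ z 2h≤q) ⟩
        q ℕ.* z ℕ.+ 4                      ≤⟨ qz+4≤n ⟩
        n                                  ∎
        where
        open ℕₚ.≤-Reasoning
        e : ∀ h z → h ℕ.* z ℕ.+ 2 ℕ.+ (h ℕ.* z ℕ.+ 2) ≡ (h ℕ.+ h) ℕ.* z ℕ.+ 4
        e = ℕ-solve-∀

theorem5 : ExcludedMiddle 0ℓ → (R : CompleteOrderedField) →
    let open CompleteOrderedField R
        open Search R
    in (β : ℝ) → 0# < β →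
       (β ≤ fromℕ 13 / fromℕ 34 → Ŝ[ β ]≤ fromℕ 4) ×
       (β ≤ fromℕ 47 / fromℕ 110 → Ŝ[ β ]≤ fromℕ 6) ×
       (β ≤ fromℕ 157 / fromℕ 346 → Ŝ[ β ]≤ fromℕ 8)
theorem5 em R β 0<β =
  (λ β≤ → fromℕ 4 , ≤-refl , achievable (ℕ.s≤s ℕ.z≤n) (ℕ.s≤s ℕ.z≤n) schedule₁ ℕₚ.≤-refl β 0<β β≤) ,
  (λ β≤ → fromℕ 6 , ≤-refl , achievable (ℕ.s≤s ℕ.z≤n) (ℕ.s≤s ℕ.z≤n) schedule₂ ℕₚ.≤-refl β 0<β β≤) ,
  (λ β≤ → fromℕ 8 , ≤-refl , achievable (ℕ.s≤s ℕ.z≤n) (ℕ.s≤s ℕ.z≤n) schedule₃ ℕₚ.≤-refl β 0<β β≤)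
  where
  open CompleteOrderedField R
  open RealArithmetic R
  open LineSearch em R
  -- The threshold a grows by the factor 3/2 at each restart, h drops by a/2, and
  -- the last sweeps have b = (p − d)/3 and h = 4 b.
  schedule₁ : Schedule 13 34 1 17 0
  schedule₁ = step 4 12 (final 3)
  schedule₂ : Schedule 47 110 2 55 0
  schedule₂ = step 8 51 (step 12 36 (final 9))
  schedule₃ : Schedule 157 346 3 173 0
  schedule₃ = step 16 165 (step 24 153 (step 36 108 (final 27)))
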